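{- Let $[R]$ be a toric poset that is not a toric total order (i.e. the underlying graph of its toric transitive closure $\overline{[R]}$ is not complete). Then at least one of the following two steps applies to $[R]$: (A) there are torically incomparable $a,b$ in different connected components of the underlying graph of $[R]$, in which case $\mathcal{L}_{\rm tor}([R])=\mathcal{L}_{\rm tor}([R_{a\to b}])$; replace $[R]$ by $[R_{a\to b}]$; (B) there are torically incomparable $a,b$ at distance two in the underlying graph of $\overline{[R]}$, both adjacent there to some vertex $v$, in which case, for any $R'\in\overline{[R]}$ having $v$ as a source, $\mathcal{L}_{\rm tor}([R])=\mathcal{L}_{\rm tor}([R'_{a\to b}])\sqcup\mathcal{L}_{\rm tor}([R'_{b\to a}])$; replace $[R]$ by the two toric posets $[R'_{a\to b}]$ and $[R'_{b\to a}]$. Consequently, for any toric poset $[Q]$, iterating these steps starting from $[Q]$ is a finite algorithm for finding $\mathcal{L}_{\rm tor}([Q])$: the process terminates, and the resulting toric posets correspond to toric total orders $[w]$, namely exactly the elements of $\mathcal{L}_{\rm tor}([Q])$.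
   Context: All quivers are finite directed graphs that are simple (no loops, no parallel or anti-parallel arcs) and acyclic (no directed cycles), on a vertex set $V=[n]$. A source is a vertex all of whose incident arcs point away from it; a sink is a vertex all of whose incident arcs point into it (an isolated vertex is both). A flip at a source or sink $k$ reverses all arcs incident to $k$. Two acyclic quivers are equivalent if they are related by a finite sequence of flips; the equivalence class $[Q]$ is called a toric poset; all its members have the same underlying undirected graph. If neither $a\to b$ nor $b\to a$ is in $Q$, then $Q_{a\to b}$ is $Q$ with the arc $a\to b$ added (similarly $Q_{b\to a}$). A toric directed path in $Q'$ is a sequence of distinct vertices $y_1,\dots,y_m$ such that $Q'$ contains the arcs $y_1\to y_2\to\cdots\to y_m$ and also the arc $y_1\to y_m$ (a single vertex and a single arc also count). A toric chain of $[Q]$ is a subset of $V$ that is totally ordered in the poset induced by every quiver in $[Q]$ (where $i<j$ if there is a directed path from $i$ to $j$); it is known that a subset is a toric chain if and only if its elements lie on a common toric directed path (in one, equivalently every, $Q'\in[Q]$). Two elements are torically comparable if they lie on a common toric chain, and torically incomparable otherwise. For $Q'\in[Q]$, the toric transitive closure $\overline{Q'}$ is obtained from $Q'$ by adding, for all $i,j$ lying on a common toric chain, the arc $i\to j$ where $i$ precedes $j$ along a toric directed path of $Q'$ containing both. The toric transitive closure of $[Q]$ is $\overline{[Q]}:=[\overline{Q'}]$, known to be independent of the choice of $Q'\in[Q]$. A toric total order $[w]=[(w_1,\dots,w_n)]$ is the equivalence class of a permutation of $V$ under cyclic rotation; it is identified with the toric poset of the acyclic orientation of the complete graph with $w_i\to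 w_j$ for $i<j$. A toric poset whose toric transitive closure has complete underlying graph corresponds to the toric total order given by that closure. For a graph $G$ on $V$, let $\mathcal{A}_{\rm tor}(G)$ be the image in $\mathbb{R}^n/\mathbb{Z}^n$ of $\bigcup_{\{i,j\}\in G}\{x_i=x_j\}\subset\mathbb{R}^n$. A point of $\mathbb{R}^n/\mathbb{Z}^n-\mathcal{A}_{\rm tor}(G)$ determines an acyclic orientation of $G$: $i\to j$ if $x_i \bmod 1< x_j \bmod 1$ (values in $[0,1)$), and $j\to i$ otherwise. For a toric poset $[Q]$ with underlying graph $G$, its toric chamber $c_{[Q]}$ is the set of points whose orientation lies in $[Q]$ (these sets are exactly the connected components of $\mathbb{R}^n/\mathbb{Z}^n-\mathcal{A}_{\rm tor}(G)$). For a toric total order $[w]$, $c_{[w]}$ is the set of points with pairwise distinct coordinates such that listing the indices in increasing order of $x_i\bmod 1$ gives a member of $[w]$. $[w]$ is a toric total extension of $[Q]$ if $c_{[w]}\subseteq c_{[Q]}$; the set of these is $\mathcal{L}_{\rm tor}([Q])$. -}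

module Defs where

open import Data.Bool.Base using (Bool; T; if_then_else_; _∨_)
open import Data.Bool.Properties using (T?)
open import Data.Empty using (⊥-elim)
open import Data.Fin.Base as Fin using (Fin; zero; suc)
open import Data.Fin.Properties as Finₚ using (_≟_)
open import Data.Fin.Permutation using (Permutation′; _⟨$⟩ʳ_; _⟨$⟩ˡ_)
open import Data.Fin.Subset using (Subset; ⁅_⁆) renaming (_∈_ to _∈ₛ_; _∪_ to _∪ₛ_)
open import Data.Fin.Subset.Properties using (x∈⁅x⁆; x∈⁅y⁆⇒x≡y; x∈p∪q⁺; x∈p∪q⁻)
open import Data.Integer.Base as ℤ using (ℤ)
open import Data.List.Base using (List; []; _∷_; _++_; _∷ʳ_; length; lookup; tabulate; InitLast; initLast; _∷ʳ′_)
open import Data.List.Properties using (length-++)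
open import Data.List.Membership.Propositional using (_∈_)
open import Data.List.Membership.Propositional.Properties using (∈-lookup; ∈-++⁺ʳ)
import Data.List.Membership.DecPropositional as DecMem
open import Data.List.Relation.Binary.Permutation.Propositional using (_↭_; ↭-sym; ↭⇒↭ₛ)
open import Data.List.Relation.Binary.Permutation.Propositional.Properties using (∷↭∷ʳ; ∈-resp-↭)
import Data.List.Relation.Binary.Permutation.Setoid.Properties as Permₛ
open import Data.List.Relation.Unary.All as All using (All; []; _∷_)
open import Data.List.Relation.Unary.AllPairs using (AllPairs; []; _∷_)
open import Data.List.Relation.Unary.Any using (Any; here; there)
open import Data.List.Relation.Unary.Linked as Linked using (Linked; []; [-]; _∷_; linked?)
open import Data.List.Relation.Unary.Unique.Propositional using (Unique)
open import Data.List.Relation.Unary.Unique.DecPropositional using (unique?)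
open import Data.Nat.Base as ℕ using (ℕ; zero; suc; z≤n; s≤s)
import Data.Nat.Properties as ℕₚ
open import Data.Product.Base using (∃; ∃-syntax; _×_; _,_; proj₁; proj₂)
open import Data.Rational.Base as ℚ using (ℚ; 0ℚ; 1ℚ)
import Data.Rational.Properties as ℚₚ
open import Data.Sum.Base using (_⊎_; inj₁; inj₂)
open import Data.Unit.Base using (tt)
open import Function.Base using (_∘_; id)
open import Function.Bundles using (_⇔_)
open import Level using (0ℓ) renaming (suc to lsuc)
open import Relation.Binary.Core using (Rel)
open import Relation.Binary.Definitions using (Decidable; tri<; tri≈; tri>)
open import Relation.Binary.Construct.Closure.ReflexiveTransitive using (Star; ε; _◅_)
open import Relation.Binary.Construct.Closure.Transitive using (TransClosure; [_]; _∷_) renaming (_++_ to _++⁺_)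
open import Relation.Binary.PropositionalEquality using (_≡_; _≢_; refl; sym; trans; cong; subst; setoid)
open import Relation.Nullary using (¬_; Dec; yes; no; does; ⌊_⌋)
open import Relation.Nullary.Decidable using (toWitness; map′; _×-dec_; _⊎-dec_; dec-false; dec-true)
open import Relation.Unary using (Pred; _⊆_)

private
  variable
    n : ℕ

------------------------------------------------------------------------
-- Quivers

Acyclic : {A : Set} → Rel A 0ℓ → Set
Acyclic _⟶_ = ∀ {i} → ¬ TransClosure _⟶_ i i

-- Loops and anti-parallel arcs are directed cycles of length one and two,
-- and an arc relation leaves no room for parallel arcs.
record Quiver (n : ℕ) : Set where
  field
    arc : Fin n → Fin n → Bool

  infix 4 _⟶_
  _⟶_ : Rel (Fin n) 0ℓ
  i ⟶ j = T (arc i j)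

  field
    acyclic : Acyclic _⟶_

  _⟶?_ : Decidable _⟶_
  i ⟶? j = T? (arc i j)

  Adjacent : Rel (Fin n) 0ℓ
  Adjacent i j = i ⟶ j ⊎ j ⟶ i

  infix 4 _≺_
  _≺_ : Rel (Fin n) 0ℓ
  _≺_ = TransClosure _⟶_

  IsSource : Pred (Fin n) 0ℓ
  IsSource k = ∀ j → ¬ j ⟶ k

  IsSink : Pred (Fin n) 0ℓ
  IsSink k = ∀ j → ¬ k ⟶ j

open Quiver public using (arc; acyclic; Adjacent; IsSource; IsSink)

infix 4 arrow reach
arrow reach : Quiver n → Rel (Fin n) 0ℓ
arrow = Quiver._⟶_
reach = Quiver._≺_
syntax arrow Q i j = i ⟶[ Q ] j
syntax reach Q i j = i ≺[ Q ] j

module PathClosure where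
  mapPath : ∀ {A : Set} {R S : Rel A 0ℓ} → (∀ {i j} → R i j → S i j) →
            ∀ {i j} → TransClosure R i j → TransClosure S i j
  mapPath f [ r ]   = [ f r ]
  mapPath f (r ∷ p) = f r ∷ mapPath f p

  bindPath : ∀ {A : Set} {R S : Rel A 0ℓ} → (∀ {i j} → R i j → TransClosure S i j) →
             ∀ {i j} → TransClosure R i j → TransClosure S i j
  bindPath f [ r ]   = f r
  bindPath f (r ∷ p) = f r ++⁺ bindPath f p

open PathClosure

fromRelation : (R : Rel (Fin n) 0ℓ) → Decidable R → Acyclic R → Quiver n
fromRelation R R? acyclic = record
  { arc     = λ i j → ⌊ R? i j ⌋
  ; acyclic = acyclic ∘ mapPath toWitness
  }

SameArcs : Rel (Quiver n) 0ℓ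
SameArcs Q Q′ = ∀ i j → arc Q i j ≡ arc Q′ i j

data Walk (Q : Quiver n) : ℕ → Rel (Fin n) 0ℓ where
  []  : ∀ {i} → Walk Q 0 i i
  _∷_ : ∀ {d i j k} → Adjacent Q i j → Walk Q d j k → Walk Q (suc d) i k

Connected : Quiver n → Rel (Fin n) 0ℓ
Connected Q i j = ∃[ d ] Walk Q d i j

Distance : Quiver n → ℕ → Rel (Fin n) 0ℓ
Distance Q d i j = Walk Q d i j × (∀ e → e ℕ.< d → ¬ Walk Q e i j)

Complete : Quiver n → Set
Complete Q = ∀ i j → i ≢ j → Adjacent Q i j

------------------------------------------------------------------------
-- Flips and toric posets

Flip : Rel (Quiver n) 0ℓ
Flip Q Q′ = ∃[ k ] (IsSource Q k ⊎ IsSink Q k) ×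
  (∀ i j → arc Q′ i j ≡ (if does (i ≟ k) ∨ does (j ≟ k) then arc Q j i else arc Q i j))

-- A toric poset [Q] is given by any representative Q, and equality of
-- toric posets is _∼_.  Quivers with the same arcs need not be
-- propositionally equal, hence the SameArcs.
infix 4 _∼_
_∼_ : Rel (Quiver n) 0ℓ
Q ∼ Q′ = ∃[ Q″ ] Star Flip Q Q″ × SameArcs Q″ Q′

-- zs = [] is the case of a single arc y ⟶ z.
data ToricPath (Q : Quiver n) : List (Fin n) → Set where
  single : ∀ y → ToricPath Q (y ∷ [])
  closed : ∀ {y zs z} → Unique (y ∷ zs ∷ʳ z) → Linked (Quiver._⟶_ Q) (y ∷ zs ∷ʳ z) →
           y ⟶[ Q ] z → ToricPath Q (y ∷ zs ∷ʳ z)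

TotallyOrdered : Quiver n → Subset n → Set
TotallyOrdered Q S = ∀ i j → i ∈ₛ S → j ∈ₛ S → i ≡ j ⊎ i ≺[ Q ] j ⊎ j ≺[ Q ] i

ToricChain : Quiver n → Subset n → Set
ToricChain Q S = ∀ Q′ → Q ∼ Q′ → TotallyOrdered Q′ S

Comparable : Quiver n → Rel (Fin n) 0ℓ
Comparable Q i j = ∃[ S ] ToricChain Q S × i ∈ₛ S × j ∈ₛ S

Incomparable : Quiver n → Rel (Fin n) 0ℓ
Incomparable Q i j = ¬ Comparable Q i j

data Precedes {A : Set} (i j : A) : List A → Set where
  here  : ∀ {ys} → j ∈ ys → Precedes i j (i ∷ ys)
  there : ∀ {y ys} → Precedes i j ys → Precedes i j (y ∷ ys)

PathArc : Quiver n → Rel (Fin n) 0ℓ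
PathArc Q i j = ∃[ ys ] ToricPath Q ys × Precedes i j ys

ClosureArc : Quiver n → Rel (Fin n) 0ℓ
ClosureArc Q i j = i ⟶[ Q ] j ⊎ (Comparable Q i j × PathArc Q i j)

------------------------------------------------------------------------
-- ClosureArc is acyclic and decidable.  Decidability uses that elements
-- of a toric directed path form a toric chain.

module ToricPathLemmas where
  module _ {Q : Quiver n} where

    linked-∈ : ∀ {x ys j} → Linked (Quiver._⟶_ Q) (x ∷ ys) → j ∈ ys → x ≺[ Q ] j
    linked-∈ (a ∷ l) (here refl) = [ a ]
    linked-∈ (a ∷ l) (there j∈)  = a ∷ linked-∈ l j∈

    linked-precedes : ∀ {ys i j} → Linked (Quiver._⟶_ Q) ys → Precedes i j ys → i ≺[ Q ] j
    linked-precedes l (here j∈) = linked-∈ l j∈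
    linked-precedes l (there p) = linked-precedes (Linked.tail l) p

    toric-linked : ∀ {ys} → ToricPath Q ys → Linked (Quiver._⟶_ Q) ys
    toric-linked (single y)     = [-]
    toric-linked (closed _ l _) = l

    closureArc-≺ : ∀ {i j} → ClosureArc Q i j → i ≺[ Q ] j
    closureArc-≺ (inj₁ a)                 = [ a ]
    closureArc-≺ (inj₂ (_ , _ , t , pre)) = linked-precedes (toric-linked t) pre

  ∈-precedes : ∀ {A : Set} {ys : List A} {i j} → i ∈ ys → j ∈ ys →
               i ≡ j ⊎ Precedes i j ys ⊎ Precedes j i ys
  ∈-precedes (here refl) (here refl) = inj₁ refl
  ∈-precedes (here refl) (there j∈)  = inj₂ (inj₁ (here j∈))
  ∈-precedes (there i∈)  (here refl) = inj₂ (inj₂ (here i∈))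
  ∈-precedes (there i∈)  (there j∈) with ∈-precedes i∈ j∈
  ... | inj₁ e        = inj₁ e
  ... | inj₂ (inj₁ p) = inj₂ (inj₁ (there p))
  ... | inj₂ (inj₂ p) = inj₂ (inj₂ (there p))

  precedes-∈ˡ : ∀ {A : Set} {ys : List A} {i j} → Precedes i j ys → i ∈ ys
  precedes-∈ˡ (here _)  = here refl
  precedes-∈ˡ (there p) = there (precedes-∈ˡ p)

  precedes-∈ʳ : ∀ {A : Set} {ys : List A} {i j} → Precedes i j ys → j ∈ ys
  precedes-∈ʳ (here j∈) = there j∈
  precedes-∈ʳ (there p) = there (precedes-∈ʳ p)

  linked-init : ∀ {A : Set} {R : Rel A 0ℓ} xs {z} → Linked R (xs ∷ʳ z) → Linked R xs
  linked-init []           _       = []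
  linked-init (x ∷ [])     _       = [-]
  linked-init (x ∷ y ∷ xs) (r ∷ l) = r ∷ linked-init (y ∷ xs) l

  linked-snoc : ∀ {A : Set} {R : Rel A 0ℓ} xs {z y} →
                Linked R (xs ∷ʳ z) → R z y → Linked R ((xs ∷ʳ z) ∷ʳ y)
  linked-snoc []           _       r = r ∷ [-]
  linked-snoc (x ∷ [])     (s ∷ l) r = s ∷ linked-snoc [] l r
  linked-snoc (x ∷ y ∷ xs) (s ∷ l) r = s ∷ linked-snoc (y ∷ xs) l r

  linked-map-∉ : ∀ {A : Set} {R S : Rel A 0ℓ} {k : A} →
                 (∀ {i j} → i ≢ k → j ≢ k → R i j → S i j) →
                 ∀ {xs} → All (_≢ k) xs → Linked R xs → Linked S xs
  linked-map-∉ f _               []      = []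
  linked-map-∉ f _               [-]     = [-]
  linked-map-∉ f (p ∷ q ∷ ps) (r ∷ l) = f p q r ∷ linked-map-∉ f (q ∷ ps) l

  hasPredecessor : ∀ {A : Set} {R : Rel A 0ℓ} {y ys k} →
                   Linked R (y ∷ ys) → k ∈ ys → ∃[ j ] R j k
  hasPredecessor (r ∷ l) (here refl) = _ , r
  hasPredecessor (r ∷ l) (there k∈)  = hasPredecessor l k∈

  hasSuccessor : ∀ {A : Set} {R : Rel A 0ℓ} xs {z k} →
                 Linked R (xs ∷ʳ z) → k ∈ xs → ∃[ j ] R k j
  hasSuccessor (x ∷ [])     (r ∷ l) (here refl) = _ , r
  hasSuccessor (x ∷ y ∷ xs) (r ∷ l) (here refl) = _ , r
  hasSuccessor (x ∷ y ∷ xs) (r ∷ l) (there k∈)  = hasSuccessor (y ∷ xs) l k∈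

  unique-↭ : ∀ {xs ys : List (Fin n)} → xs ↭ ys → Unique xs → Unique ys
  unique-↭ {n} p = Permₛ.Unique-resp-↭ (setoid (Fin n)) (↭⇒↭ₛ p)

  ∈⇒≢ : ∀ {A : Set} {k : A} {xs} → ¬ k ∈ xs → All (_≢ k) xs
  ∈⇒≢ {xs = []}     _  = []
  ∈⇒≢ {xs = x ∷ xs} k∉ = (λ e → k∉ (here (sym e))) ∷ ∈⇒≢ (k∉ ∘ there)

  unique-head : ∀ {A : Set} {x : A} {xs} → Unique (x ∷ xs) → All (_≢ x) xs
  unique-head (p ∷ _) = All.map (_∘ sym) p

  RotatedPath : Quiver n → List (Fin n) → Set
  RotatedPath Q xs = ∃[ ys ] ToricPath Q ys × (∀ {x} → x ∈ xs → x ∈ ys)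

  last-arc : ∀ {A : Set} {R : Rel A 0ℓ} xs {u z} → Linked R ((xs ∷ʳ u) ∷ʳ z) → R u z
  last-arc []           (r ∷ _) = r
  last-arc (x ∷ [])     (_ ∷ l) = last-arc [] l
  last-arc (x ∷ y ∷ xs) (_ ∷ l) = last-arc (y ∷ xs) l

  module _ {Q Q′ : Quiver n} (k : Fin n)
           (eq : ∀ i j → arc Q′ i j ≡ (if does (i ≟ k) ∨ does (j ≟ k) then arc Q j i else arc Q i j)) where

    away : ∀ {i j} → i ≢ k → j ≢ k → i ⟶[ Q ] j → i ⟶[ Q′ ] j
    away {i} {j} i≢k j≢k a with eq i j
    ... | e rewrite dec-false (i ≟ k) i≢k | dec-false (j ≟ k) j≢k = subst T (sym e) a

    out : ∀ {i} → k ⟶[ Q ] i → i ⟶[ Q′ ] k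
    out {i} a with eq i k
    ... | e with does (i ≟ k)
    ...   | Bool.true = subst T (sym e) a
    ...   | Bool.false rewrite dec-true (k ≟ k) refl = subst T (sym e) a

    into : ∀ {i} → i ⟶[ Q ] k → k ⟶[ Q′ ] i
    into {i} a with eq k i
    ... | e rewrite dec-true (k ≟ k) refl = subst T (sym e) a

    unmoved : ∀ {y zs z} → Unique (y ∷ zs ∷ʳ z) → Linked (Quiver._⟶_ Q) (y ∷ zs ∷ʳ z) →
              y ⟶[ Q ] z → ¬ k ∈ y ∷ zs ∷ʳ z → RotatedPath Q′ (y ∷ zs ∷ʳ z)
    unmoved {y} {zs} {z} un l c k∉ =
      _ , closed {zs = zs} un (linked-map-∉ away ≢k l)
            (away (All.lookup ≢k (here refl)) (All.lookup ≢k (∈-++⁺ʳ (y ∷ zs) (here refl))) c)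
        , id
      where ≢k = ∈⇒≢ k∉

    rotate-source : ∀ zs {z} → Unique (k ∷ zs ∷ʳ z) → Linked (Quiver._⟶_ Q) (k ∷ zs ∷ʳ z) →
                    k ⟶[ Q ] z → RotatedPath Q′ (k ∷ zs ∷ʳ z)
    rotate-source [] {z} un (a ∷ l) c =
      _ , closed {zs = []} (unique-↭ p un) (linked-snoc [] [-] (out a)) (out a) , ∈-resp-↭ p
      where p = ∷↭∷ʳ k (z ∷ [])
    rotate-source (u ∷ us) {z} un (a ∷ l) c =
      _ , closed {zs = us ∷ʳ z} (unique-↭ p un)
            (linked-snoc (u ∷ us) (linked-map-∉ away (unique-head un) l) (out c)) (out a)
        , ∈-resp-↭ p
      where p = ∷↭∷ʳ k (u ∷ us ∷ʳ z)

    rotate-sink : ∀ zs {y} → Unique (y ∷ zs ∷ʳ k) → Linked (Quiver._⟶_ Q) (y ∷ zs ∷ʳ k) →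
                  y ⟶[ Q ] k → RotatedPath Q′ (y ∷ zs ∷ʳ k)
    rotate-sink zs un l c with initLast zs
    rotate-sink .[] {y} un l c | [] =
      _ , closed {zs = []} (unique-↭ p un) (into c ∷ [-]) (into c) , ∈-resp-↭ p
      where p = ↭-sym (∷↭∷ʳ k (y ∷ []))
    rotate-sink .(us ∷ʳ u) {y} un l c | us ∷ʳ′ u =
      _ , closed {zs = y ∷ us} un′
            (into c ∷ linked-map-∉ away (unique-head un′) (linked-init (y ∷ us ∷ʳ u) l))
            (into (last-arc (y ∷ us) l))
        , ∈-resp-↭ p
      where p = ↭-sym (∷↭∷ʳ k (y ∷ us ∷ʳ u))
            un′ = unique-↭ p un

    ∈-snoc : ∀ {x z : Fin n} xs → x ∈ xs ∷ʳ z → x ∈ xs ⊎ x ≡ z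
    ∈-snoc []       (here e) = inj₂ e
    ∈-snoc (y ∷ xs) (here e) = inj₁ (here e)
    ∈-snoc (y ∷ xs) (there x∈) with ∈-snoc xs x∈
    ... | inj₁ x∈′ = inj₁ (there x∈′)
    ... | inj₂ e   = inj₂ e

    flip-path : IsSource Q k ⊎ IsSink Q k → ∀ {ys} → ToricPath Q ys → RotatedPath Q′ ys
    flip-path _ (single y) = _ , single y , id
    flip-path (inj₁ src) (closed {y} {zs} {z} un l c) with k ≟ y
    ... | yes refl = rotate-source zs un l c
    ... | no k≢y = unmoved un l c λ where
      (here e)   → k≢y e
      (there k∈) → let j , a = hasPredecessor l k∈ in src j a
    flip-path (inj₂ snk) (closed {y} {zs} {z} un l c) with k ≟ z
    ... | yes refl = rotate-sink zs un l c
    ... | no k≢z = unmoved un l c λ k∈ → elsewhere (∈-snoc (y ∷ zs) k∈)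
      where
      elsewhere : ¬ (k ∈ y ∷ zs ⊎ k ≡ z)
      elsewhere (inj₁ k∈) = let j , a = hasSuccessor (y ∷ zs) l k∈ in snk j a
      elsewhere (inj₂ e)  = k≢z e

  flips-path : ∀ {Q Q′ : Quiver n} → Star Flip Q Q′ → ∀ {ys} → ToricPath Q ys → RotatedPath Q′ ys
  flips-path ε t = _ , t , id
  flips-path ((k , s , eq) ◅ fs) t =
    let _ , t₁ , sub₁ = flip-path k eq s t
        _ , t₂ , sub₂ = flips-path fs t₁
    in _ , t₂ , sub₂ ∘ sub₁

  sameArcs-≺ : ∀ {Q Q′ : Quiver n} → SameArcs Q Q′ → ∀ {i j} → i ≺[ Q ] j → i ≺[ Q′ ] j
  sameArcs-≺ same = mapPath λ {i} {j} → subst T (same i j)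

  pathArc⇒comparable : ∀ {Q : Quiver n} {i j} → PathArc Q i j → Comparable Q i j
  pathArc⇒comparable {n} {Q} {i} {j} (ys , t , pre) =
    ⁅ i ⁆ ∪ₛ ⁅ j ⁆ , chain , x∈p∪q⁺ (inj₁ (x∈⁅x⁆ i)) , x∈p∪q⁺ (inj₂ (x∈⁅x⁆ j))
    where
    ∈ys : ∀ x → x ∈ₛ ⁅ i ⁆ ∪ₛ ⁅ j ⁆ → x ∈ ys
    ∈ys x x∈ with x∈p∪q⁻ ⁅ i ⁆ ⁅ j ⁆ x∈
    ... | inj₁ m = subst (_∈ ys) (sym (x∈⁅y⁆⇒x≡y i m)) (precedes-∈ˡ pre)
    ... | inj₂ m = subst (_∈ ys) (sym (x∈⁅y⁆⇒x≡y j m)) (precedes-∈ʳ pre)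

    chain : ToricChain Q (⁅ i ⁆ ∪ₛ ⁅ j ⁆)
    chain Q′ (Q″ , fs , same) k l k∈ l∈ with flips-path fs t
    ... | _ , t′ , sub with ∈-precedes (sub (∈ys k k∈)) (sub (∈ys l l∈))
    ...   | inj₁ e        = inj₁ e
    ...   | inj₂ (inj₁ p) = inj₂ (inj₁ (sameArcs-≺ {Q = Q″} {Q′} same (linked-precedes {Q = Q″} (toric-linked t′) p)))
    ...   | inj₂ (inj₂ p) = inj₂ (inj₂ (sameArcs-≺ {Q = Q″} {Q′} same (linked-precedes {Q = Q″} (toric-linked t′) p)))

  lookup-unique : ∀ {A : Set} {xs : List A} → Unique xs →
                  ∀ i j → lookup xs i ≡ lookup xs j → i ≡ j
  lookup-unique {xs = _ ∷ _} _        zero    zero    _ = refl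
  lookup-unique {xs = _ ∷ _} (p ∷ _)  zero    (suc j) e = ⊥-elim (All.lookup p (∈-lookup j) e)
  lookup-unique {xs = _ ∷ _} (p ∷ _)  (suc i) zero    e = ⊥-elim (All.lookup p (∈-lookup i) (sym e))
  lookup-unique {xs = _ ∷ _} (_ ∷ ps) (suc i) (suc j) e = cong suc (lookup-unique ps i j e)

  unique-length : ∀ {xs : List (Fin n)} → Unique xs → length xs ℕ.≤ n
  unique-length un = Finₚ.injective⇒≤ (λ {i} {j} → lookup-unique un i j)

  bounded∃? : ∀ m {P : Pred (List (Fin n)) 0ℓ} → (∀ xs → Dec (P xs)) →
              Dec (∃[ xs ] length xs ℕ.≤ m × P xs)
  bounded∃? zero P? = map′ (λ p → [] , z≤n , p) (λ { ([] , _ , p) → p }) (P? [])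
  bounded∃? (suc m) {P} P? =
    map′ to from (P? [] ⊎-dec Finₚ.any? λ x → bounded∃? m λ xs → P? (x ∷ xs))
    where
    to : P [] ⊎ (∃[ x ] ∃[ xs ] length xs ℕ.≤ m × P (x ∷ xs)) → ∃[ xs ] length xs ℕ.≤ suc m × P xs
    to (inj₁ p)                = [] , z≤n , p
    to (inj₂ (x , xs , b , p)) = x ∷ xs , s≤s b , p
    from : (∃[ xs ] length xs ℕ.≤ suc m × P xs) → P [] ⊎ (∃[ x ] ∃[ xs ] length xs ℕ.≤ m × P (x ∷ xs))
    from ([]     , _     , p) = inj₁ p
    from (x ∷ xs , s≤s b , p) = inj₂ (x , xs , b , p)

  precedes? : ∀ (i j : Fin n) ys → Dec (Precedes i j ys)
  precedes? i j []       = no λ ()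
  precedes? i j (y ∷ ys) = map′ to from ((i ≟ y ×-dec DecMem._∈?_ _≟_ j ys) ⊎-dec precedes? i j ys)
    where
    to : (i ≡ y × j ∈ ys) ⊎ Precedes i j ys → Precedes i j (y ∷ ys)
    to (inj₁ (refl , j∈)) = here j∈
    to (inj₂ p)           = there p
    from : Precedes i j (y ∷ ys) → (i ≡ y × j ∈ ys) ⊎ Precedes i j ys
    from (here j∈) = inj₁ (refl , j∈)
    from (there p) = inj₂ p

  pathArc? : (Q : Quiver n) → Decidable (PathArc Q)
  pathArc? {n} Q i j = map′ to from
    (Finₚ.any? λ y → Finₚ.any? λ z → bounded∃? n λ zs →
      unique? _≟_ (y ∷ zs ∷ʳ z) ×-dec linked? (Quiver._⟶?_ Q) (y ∷ zs ∷ʳ z)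
        ×-dec (Quiver._⟶?_ Q y z) ×-dec precedes? i j (y ∷ zs ∷ʳ z))
    where
    Closed : Fin n → Fin n → List (Fin n) → Set
    Closed y z zs = Unique (y ∷ zs ∷ʳ z) × Linked (Quiver._⟶_ Q) (y ∷ zs ∷ʳ z)
                      × y ⟶[ Q ] z × Precedes i j (y ∷ zs ∷ʳ z)
    to : (∃[ y ] ∃[ z ] ∃[ zs ] length zs ℕ.≤ n × Closed y z zs) → PathArc Q i j
    to (y , z , zs , _ , un , l , c , pre) = _ , closed {zs = zs} un l c , pre
    from : PathArc Q i j → ∃[ y ] ∃[ z ] ∃[ zs ] length zs ℕ.≤ n × Closed y z zs
    from (_ , single y , here ())
    from (_ , single y , there ())
    from (_ , closed {y} {zs} {z} un l c , pre) = y , z , zs , bound , un , l , c , pre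
      where
      bound : length zs ℕ.≤ n
      bound = ℕₚ.≤-trans (ℕₚ.m≤m+n (length zs) 1)
                (ℕₚ.≤-trans (ℕₚ.≤-reflexive (sym (length-++ zs)))
                  (ℕₚ.≤-trans (ℕₚ.n≤1+n _) (unique-length un)))

  closureArc? : (Q : Quiver n) → Decidable (ClosureArc Q)
  closureArc? Q i j = Quiver._⟶?_ Q i j ⊎-dec
    map′ (λ p → pathArc⇒comparable p , p) proj₂ (pathArc? Q i j)

open ToricPathLemmas

------------------------------------------------------------------------
-- Toric transitive closure, adding an arc, toric total orders

closure : Quiver n → Quiver n
closure Q = fromRelation (ClosureArc Q) (closureArc? Q) (acyclic Q ∘ bindPath closureArc-≺)

data ExtendedArc (Q : Quiver n) (a b : Fin n) : Rel (Fin n) 0ℓ where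
  old : ∀ {i j} → i ⟶[ Q ] j → ExtendedArc Q a b i j
  new : ExtendedArc Q a b a b

record Addable (Q : Quiver n) (a b : Fin n) : Set where
  field
    nonadjacent : ¬ Adjacent Q a b
    acyclic     : Acyclic (ExtendedArc Q a b)

addArc : (Q : Quiver n) (a b : Fin n) → Addable Q a b → Quiver n
addArc {n} Q a b ok = fromRelation (ExtendedArc Q a b) ext? (Addable.acyclic ok)
  where
  ext? : Decidable (ExtendedArc Q a b)
  ext? i j = map′ to from (Quiver._⟶?_ Q i j ⊎-dec (i ≟ a ×-dec j ≟ b))
    where
    to : i ⟶[ Q ] j ⊎ (i ≡ a × j ≡ b) → ExtendedArc Q a b i j
    to (inj₁ r)             = old r
    to (inj₂ (refl , refl)) = new
    from : ExtendedArc Q a b i j → i ⟶[ Q ] j ⊎ (i ≡ a × j ≡ b)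
    from (old r) = inj₁ r
    from new     = inj₂ (refl , refl)

-- w stands for (w ⟨$⟩ʳ 0 , … , w ⟨$⟩ʳ (n-1)).
listing : Permutation′ n → List (Fin n)
listing w = tabulate (w ⟨$⟩ʳ_)

infix 4 _≈rot_
_≈rot_ : Rel (Permutation′ n) 0ℓ
w ≈rot w′ = ∃[ us ] ∃[ vs ] listing w ≡ us ++ vs × listing w′ ≡ vs ++ us

totalQuiver : Permutation′ n → Quiver n
totalQuiver {n} w = fromRelation _before_ (λ i j → w ⟨$⟩ˡ i Finₚ.<? w ⟨$⟩ˡ j) (ℕₚ.<-irrefl refl ∘ collapse)
  where
  _before_ : Rel (Fin n) 0ℓ
  i before j = w ⟨$⟩ˡ i Fin.< w ⟨$⟩ˡ j
  collapse : ∀ {i j} → TransClosure _before_ i j → i before j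
  collapse [ r ]   = r
  collapse (r ∷ p) = ℕₚ.<-trans r (collapse p)

IsToricTotalOrder : Quiver n → Set
IsToricTotalOrder Q = Complete (closure Q)

CorrespondsTo : Quiver n → Permutation′ n → Set
CorrespondsTo Q w = IsToricTotalOrder Q × closure Q ∼ totalQuiver w

------------------------------------------------------------------------
-- Real numbers

-- Two-sided Dedekind cuts.
record ℝ : Set₁ where
  field
    Lower Upper     : Pred ℚ 0ℓ
    lower-inhabited : ∃ Lower
    upper-inhabited : ∃ Upper
    lower-closed    : ∀ {p q} → p ℚ.< q → Lower q → Lower p
    upper-closed    : ∀ {p q} → p ℚ.< q → Upper p → Upper q
    lower-open      : ∀ {p} → Lower p → ∃[ q ] p ℚ.< q × Lower q
    upper-open      : ∀ {q} → Upper q → ∃[ p ] p ℚ.< q × Upper p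
    disjoint        : ∀ {q} → Lower q → ¬ Upper q
    located         : ∀ {p q} → p ℚ.< q → Lower p ⊎ Upper q

open ℝ public using (Lower; Upper)

infix 4 _<ᵣ_ _≤ᵣ_ _≈ᵣ_
_<ᵣ_ _≤ᵣ_ _≈ᵣ_ : Rel ℝ 0ℓ
x <ᵣ y = ∃[ q ] Upper x q × Lower y q
x ≤ᵣ y = Lower x ⊆ Lower y
x ≈ᵣ y = x ≤ᵣ y × y ≤ᵣ x

fromℚ : ℚ → ℝ
fromℚ r = record
  { Lower           = ℚ._< r
  ; Upper           = r ℚ.<_
  ; lower-inhabited = r ℚ.- 1ℚ , subst (r ℚ.- 1ℚ ℚ.<_) (ℚₚ.+-identityʳ r) (ℚₚ.+-monoʳ-< r -1<0)
  ; upper-inhabited = r ℚ.+ 1ℚ , subst (ℚ._< r ℚ.+ 1ℚ) (ℚₚ.+-identityʳ r) (ℚₚ.+-monoʳ-< r 0<1)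
  ; lower-closed    = ℚₚ.<-trans
  ; upper-closed    = λ p<q r<p → ℚₚ.<-trans r<p p<q
  ; lower-open      = λ p<r → let q , p<q , q<r = ℚₚ.<-dense p<r in q , p<q , q<r
  ; upper-open      = λ r<q → let p , r<p , p<q = ℚₚ.<-dense r<q in p , p<q , r<p
  ; disjoint        = ℚₚ.<-asym
  ; located         = split
  }
  where
  0<1 : 0ℚ ℚ.< 1ℚ
  0<1 = toWitness {a? = 0ℚ ℚₚ.<? 1ℚ} tt
  -1<0 : ℚ.- 1ℚ ℚ.< 0ℚ
  -1<0 = toWitness {a? = ℚ.- 1ℚ ℚₚ.<? 0ℚ} tt
  split : ∀ {p q} → p ℚ.< q → p ℚ.< r ⊎ r ℚ.< q
  split {p} {q} p<q with ℚₚ.<-cmp p r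
  ... | tri< p<r _ _  = inj₁ p<r
  ... | tri≈ _ refl _ = inj₂ p<q
  ... | tri> _ _ r<p  = inj₂ (ℚₚ.<-trans r<p p<q)

infixl 6 _+ᶻ_
_+ᶻ_ : ℝ → ℤ → ℝ
x +ᶻ k = record
  { Lower           = λ q → Lower x (q ℚ.- c)
  ; Upper           = λ q → Upper x (q ℚ.- c)
  ; lower-inhabited = let q , l = ℝ.lower-inhabited x in q ℚ.+ c , subst (Lower x) (sym (cancel q)) l
  ; upper-inhabited = let q , u = ℝ.upper-inhabited x in q ℚ.+ c , subst (Upper x) (sym (cancel q)) u
  ; lower-closed    = λ p<q → ℝ.lower-closed x (ℚₚ.+-monoˡ-< (ℚ.- c) p<q)
  ; upper-closed    = λ p<q → ℝ.upper-closed x (ℚₚ.+-monoˡ-< (ℚ.- c) p<q)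
  ; lower-open      = λ {p} l → let q , p-c<q , lq = ℝ.lower-open x l in
      q ℚ.+ c , subst (ℚ._< q ℚ.+ c) (cancel′ p) (ℚₚ.+-monoˡ-< c p-c<q) , subst (Lower x) (sym (cancel q)) lq
  ; upper-open      = λ {q} u → let p , p<q-c , up = ℝ.upper-open x u in
      p ℚ.+ c , subst (p ℚ.+ c ℚ.<_) (cancel′ q) (ℚₚ.+-monoˡ-< c p<q-c) , subst (Upper x) (sym (cancel p)) up
  ; disjoint        = ℝ.disjoint x
  ; located         = λ p<q → ℝ.located x (ℚₚ.+-monoˡ-< (ℚ.- c) p<q)
  }
  where
  c : ℚ
  c = k ℚ./ 1
  cancel : ∀ q → q ℚ.+ c ℚ.- c ≡ q
  cancel q = trans (ℚₚ.+-assoc q c (ℚ.- c)) (trans (cong (q ℚ.+_) (ℚₚ.+-inverseʳ c)) (ℚₚ.+-identityʳ q))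
  cancel′ : ∀ q → q ℚ.- c ℚ.+ c ≡ q
  cancel′ q = trans (ℚₚ.+-assoc q (ℚ.- c) c) (trans (cong (q ℚ.+_) (ℚₚ.+-inverseˡ c)) (ℚₚ.+-identityʳ q))

InUnitInterval : Pred ℝ 0ℓ
InUnitInterval z = fromℚ 0ℚ ≤ᵣ z × z <ᵣ fromℚ 1ℚ

-- x mod 1 < y mod 1: the translates of x and y lying in [0,1) are so ordered.
infix 4 _<mod1_
_<mod1_ : Rel ℝ 0ℓ
x <mod1 y = ∃[ k ] ∃[ l ] InUnitInterval (x +ᶻ k) × InUnitInterval (y +ᶻ l) × x +ᶻ k <ᵣ y +ᶻ l

------------------------------------------------------------------------
-- Toric chambers

-- A point of ℝⁿ/ℤⁿ is given by a representative in ℝⁿ.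
Point : ℕ → Set₁
Point n = Fin n → ℝ

infix 4 _≡modℤ_
_≡modℤ_ : Rel (Point n) 0ℓ
x ≡modℤ y = ∀ i → ∃[ k ] y i ≈ᵣ x i +ᶻ k

ToricArrangement : Quiver n → Pred (Point n) (lsuc 0ℓ)
ToricArrangement Q x = ∃[ y ] x ≡modℤ y × (∃[ i ] ∃[ j ] Adjacent Q i j × y i ≈ᵣ y j)

-- O is the orientation of the underlying graph of Q determined by x.
Determines : Quiver n → Point n → Quiver n → Set
Determines Q x O = ∀ i j → i ⟶[ O ] j ⇔ (Adjacent Q i j × x i <mod1 x j)

Chamber : Quiver n → Pred (Point n) (lsuc 0ℓ)
Chamber Q x = ¬ ToricArrangement Q x × (∃[ O ] Determines Q x O × Q ∼ O)

-- Increasing order along a full listing makes the coordinates pairwise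
-- distinct mod 1.
TotalChamber : Permutation′ n → Pred (Point n) 0ℓ
TotalChamber w x = ∃[ w′ ] w ≈rot w′ × (∀ {i j} → i Fin.< j → x (w′ ⟨$⟩ʳ i) <mod1 x (w′ ⟨$⟩ʳ j))

-- Toric total extensions; [w] is given by a representative w.
𝓛 : Quiver n → Pred (Permutation′ n) (lsuc 0ℓ)
𝓛 Q w = TotalChamber w ⊆ Chamber Q

------------------------------------------------------------------------
-- The two steps and the algorithm

ConditionA : Quiver n → Fin n → Fin n → Set
ConditionA R a b = Incomparable R a b × ¬ Connected R a b

ConditionB : Quiver n → Fin n → Fin n → Fin n → Set
ConditionB R a b v = Incomparable R a b × Distance (closure R) 2 a b
                       × Adjacent (closure R) a v × Adjacent (closure R) b v

infix 4 _⇝_ _⟹_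

data _⇝_ {n} (R : Quiver n) : List (Quiver n) → Set where
  stepA : ∀ {a b} → ¬ IsToricTotalOrder R → ConditionA R a b →
          (ok : Addable R a b) → R ⇝ addArc R a b ok ∷ []
  stepB : ∀ {a b v R′} → ¬ IsToricTotalOrder R → ConditionB R a b v →
          closure R ∼ R′ → IsSource R′ v →
          (ok : Addable R′ a b) (ok′ : Addable R′ b a) →
          R ⇝ addArc R′ a b ok ∷ addArc R′ b a ok′ ∷ []

-- The state of the algorithm is the list of current toric posets, one of
-- which is replaced at a time.
data _⟹_ {n} : Rel (List (Quiver n)) 0ℓ where
  here  : ∀ {R Rs s} → R ⇝ Rs → R ∷ s ⟹ Rs ++ s
  there : ∀ {R s s′} → s ⟹ s′ → R ∷ s ⟹ R ∷ s′

Terminated : Pred (List (Quiver n)) 0ℓ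
Terminated s = ∀ s′ → ¬ s ⟹ s′

-- s consists of toric total orders and lists the elements of L, each once.
record Enumerates {n} (s : List (Quiver n)) (L : Pred (Permutation′ n) (lsuc 0ℓ)) : Set₁ where
  field
    total    : All (λ P → ∃[ w ] CorrespondsTo P w) s
    elements : ∀ w → L w ⇔ Any (λ P → CorrespondsTo P w) s
    distinct : AllPairs (λ P P′ → ∀ w → CorrespondsTo P w → ¬ CorrespondsTo P′ w) s

-- Counting the flips at each vertex turns equivalence into a height function:
-- Q ∼ Q′ iff Q and Q′ have the same underlying graph and some h satisfies, for
-- every arc i → j of Q, either i → j in Q′ and h i = h j, or j → i in Q′ and
-- h i = h j + 1.  Likewise w is a toric total extension of Q iff the linear
-- order w restricted to the graph of Q has such a height over Q.  Along a toric
-- directed path a height drops at most once, so heights over Q are heights over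
-- its closure.  Two distinct elements are incomparable iff some member of [Q]
-- has both as sources: raise a to a source by flipping its ancestors, then b;
-- failing to keep both produces a toric directed path through a and b.
-- In step (A) a height may be shifted on the component of b; in step (B) the
-- arcs v → a and v → b determine the difference of the heights of a and b, hence
-- exactly one of a → b and b → a is compatible with w.  Each step makes a new
-- pair comparable, so the process terminates.

module Submission where

open import Defs
open PathClosure using (mapPath)
open ToricPathLemmas
open import Data.Bool.Base using (true; false; T; _∨_; if_then_else_)
open import Data.Empty using (⊥-elim)
open import Data.Fin.Base as Fin using (Fin; zero; suc; toℕ; fromℕ<; punchOut; remQuot; combine)
open import Data.Fin.Induction using (spo-wellFounded)
open import Data.Fin.Permutation using (Permutation′; _⟨$⟩ʳ_; _⟨$⟩ˡ_; inverseˡ; inverseʳ; permutation)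
open import Data.Fin.Properties as Finₚ using (_≟_; any?; punchOut-injective; remQuot-combine)
open import Data.Fin.Subset using (Subset; ⁅_⁆; ⊤; ∣_∣) renaming (_∈_ to _∈ₛ_; _∪_ to _∪ₛ_; _⊃_ to _⊃ₛ_)
open import Data.Fin.Subset.Induction using (⊃-wellFounded)
open import Data.Fin.Subset.Properties using (x∈⁅x⁆; x∈⁅y⁆⇒x≡y; x∈p∪q⁺; x∈p∪q⁻; _∈?_; ∣⊤∣≡n; ∈⊤; p⊂q⇒∣p∣<∣q∣)
open import Data.Integer.Base as ℤ using (ℤ)
import Data.Integer.Properties as ℤₚ
open import Data.List.Base using (List; []; _∷_; _∷ʳ_; _++_; tabulate)
open import Data.List.Properties using (++-assoc; ++-identityʳ)
import Data.List.Membership.DecPropositional as DecMembership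
open import Data.List.Membership.Propositional using (_∈_; find; lose)
open import Data.List.Membership.Propositional.Properties using (∈-tabulate⁺; ∈-tabulate⁻; ∈-++⁺ˡ; ∈-++⁺ʳ; ∈-++⁻)
open import Data.List.Relation.Unary.All as All using ([]; _∷_)
open import Data.List.Relation.Unary.AllPairs as AllPairs using (AllPairs; []; _∷_)
import Data.List.Relation.Unary.AllPairs.Properties as AllPairsₚ
open import Data.List.Relation.Unary.Any using (Any; here; there)
import Data.List.Relation.Unary.Any.Properties as Anyₚ
open import Data.List.Relation.Unary.Linked as Linked using (Linked; []; [-]; _∷_)
open import Data.List.Relation.Unary.Unique.Propositional using (Unique)
open import Data.Nat.Base as ℕ using (ℕ; zero; suc; _+_; _∸_; z≤n; s≤s)
open import Data.Nat.Induction using (<-wellFounded)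
import Data.Nat.Properties as ℕₚ
open import Data.Product.Base using (∃-syntax; Σ-syntax; _×_; _,_; proj₁; proj₂; map₂; uncurry)
open import Data.Rational.Base as ℚ using (ℚ; 0ℚ; 1ℚ)
import Data.Rational.Properties as ℚₚ
open import Data.Rational.Unnormalised.Base as ℚᵘ using (mkℚᵘ; *≡*; *≤*)
import Data.Rational.Unnormalised.Properties as ℚᵘₚ
open import Data.Sum.Base as Sum using (_⊎_; inj₁; inj₂; [_,_]′)
import Data.Vec.Base as Vec
open import Data.Vec.Properties using (lookup∘tabulate; lookup⇒[]=; []=⇒lookup)
open import Function.Base using (_∘_; id)
open import Function.Bundles using (mk⇔; Equivalence)
open import Induction.WellFounded using (Acc; acc; WellFounded)
open import Level using (0ℓ)
open import Relation.Binary.Core using (Rel)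
open import Relation.Binary.Definitions using (Decidable; Transitive; Asymmetric; tri<; tri≈; tri>)
open import Relation.Binary.Construct.Closure.ReflexiveTransitive as Star using (Star; ε; _◅_; _◅◅_)
open import Relation.Binary.Construct.Closure.Transitive using (TransClosure; [_]; _∷_) renaming (_++_ to _++⁺_)
open import Relation.Binary.PropositionalEquality
open import Relation.Nullary using (¬_; Dec; yes; no; does; contradiction)
open import Relation.Nullary.Decidable using (toWitness; fromWitness; map′; _×-dec_; _⊎-dec_; ¬?; dec-true; dec-false; decidable-stable)
open import Relation.Unary using (_⊆_; _≐_; _∪_; _∩_; Empty)

private variable
  n : ℕ
  A : Set

-- Reachability

plus⇒star : ∀ {R : Rel A 0ℓ} {i j} → TransClosure R i j → Star R i j
plus⇒star [ r ]   = r ◅ ε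
plus⇒star (r ∷ p) = r ◅ plus⇒star p

infixr 5 _◅⁺_
_◅⁺_ : ∀ {R : Rel A 0ℓ} {i j k} → R i j → Star R j k → TransClosure R i k
r ◅⁺ ε       = [ r ]
r ◅⁺ (s ◅ p) = r ∷ s ◅⁺ p

star⇒plus : ∀ {R : Rel A 0ℓ} {i j} → Star R i j → i ≡ j ⊎ TransClosure R i j
star⇒plus ε       = inj₁ refl
star⇒plus (r ◅ p) = inj₂ (r ◅⁺ p)

last-step : ∀ {R : Rel A 0ℓ} {i j} → TransClosure R i j → ∃[ k ] R k j
last-step [ r ]   = _ , r
last-step (r ∷ p) = last-step p

module _ {R : Rel (Fin n) 0ℓ} (R? : Decidable R) where

  private
    -- `D` collects vertices known to reach `a` and grows by one predecessor at a time. Strict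
    -- growth of subsets of a finite set must stop, and a set that cannot grow is closed under
    -- predecessors, hence contains everything that reaches `a`.
    saturate : ∀ a (D : Subset n) → Acc _⊃ₛ_ D → a ∈ₛ D → (∀ {u} → u ∈ₛ D → Star R u a) →
               ∃[ E ] a ∈ₛ E × (∀ {u} → u ∈ₛ E → Star R u a) × (∀ {u v} → R u v → v ∈ₛ E → u ∈ₛ E)
    saturate a D (acc rec) a∈ sound
      with any? (λ u → any? λ v → R? u v ×-dec v ∈? D ×-dec ¬? (u ∈? D))
    ... | yes (u , v , r , v∈ , u∉) =
      saturate a (D ∪ₛ ⁅ u ⁆)
        (rec ((λ x∈ → x∈p∪q⁺ (inj₁ x∈)) , u , x∈p∪q⁺ (inj₂ (x∈⁅x⁆ u)) , u∉))
        (x∈p∪q⁺ (inj₁ a∈)) λ x∈ → [ sound , sound-u ]′ (x∈p∪q⁻ D ⁅ u ⁆ x∈)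
      where
      sound-u : ∀ {x} → x ∈ₛ ⁅ u ⁆ → Star R x a
      sound-u x∈ rewrite x∈⁅y⁆⇒x≡y u x∈ = r ◅ sound v∈
    ... | no ¬p = D , a∈ , sound , closed′
      where
      closed′ : ∀ {u v} → R u v → v ∈ₛ D → u ∈ₛ D
      closed′ {u} {v} r v∈ with u ∈? D
      ... | yes u∈ = u∈
      ... | no u∉  = contradiction (u , v , r , v∈ , u∉) ¬p

  abstract
    star? : Decidable (Star R)
    star? u a with saturate a ⁅ a ⁆ (⊃-wellFounded _) (x∈⁅x⁆ a)
      (λ x∈ → subst (λ x → Star R x a) (sym (x∈⁅y⁆⇒x≡y a x∈)) ε)
    ... | E , a∈ , sound , clos = map′ sound complete (u ∈? E)
      where
      complete : ∀ {u} → Star R u a → u ∈ₛ E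
      complete ε       = a∈
      complete (r ◅ p) = clos r (complete p)

    plus? : Decidable (TransClosure R)
    plus? u a = map′ (λ (v , r , p) → r ◅⁺ p) first (any? λ v → R? u v ×-dec star? v a)
      where
      first : TransClosure R u a → ∃[ v ] R u v × Star R v a
      first [ r ]   = _ , r , ε
      first (r ∷ p) = _ , r , plus⇒star p

does-true : ∀ {P : Set} (p? : Dec P) → does p? ≡ true → P
does-true (yes p) _ = p

indicator : ∀ {P : Set} → Dec P → ℕ
indicator p? = if does p? then 1 else 0

indicator-yes : ∀ {P : Set} (p? : Dec P) → P → indicator p? ≡ 1
indicator-yes p? p rewrite dec-true p? p = refl

indicator-no : ∀ {P : Set} (p? : Dec P) → ¬ P → indicator p? ≡ 0
indicator-no p? ¬p rewrite dec-false p? ¬p = refl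

-- Quivers

T-injective : ∀ {b c} → (T b → T c) → (T c → T b) → b ≡ c
T-injective {false} {false} _ _ = refl
T-injective {false} {true}  _ g = ⊥-elim (g _)
T-injective {true}  {false} f _ = ⊥-elim (f _)
T-injective {true}  {true}  _ _ = refl

arc-asym : ∀ (Q : Quiver n) {i j} → i ⟶[ Q ] j → ¬ j ⟶[ Q ] i
arc-asym Q r s = acyclic Q (r ∷ [ s ])

adjacent⇒≢ : ∀ (Q : Quiver n) {i j} → Adjacent Q i j → i ≢ j
adjacent⇒≢ Q (inj₁ r) refl = acyclic Q [ r ]
adjacent⇒≢ Q (inj₂ r) refl = acyclic Q [ r ]

abstract
  adjacent? : (Q : Quiver n) → Decidable (Adjacent Q)
  adjacent? Q i j = Quiver._⟶?_ Q i j ⊎-dec Quiver._⟶?_ Q j i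

≺-wellFounded : (Q : Quiver n) → WellFounded (Quiver._≺_ Q)
≺-wellFounded Q = spo-wellFounded record
  { isEquivalence = isEquivalence
  ; irrefl        = λ { refl → acyclic Q }
  ; trans         = _++⁺_
  ; <-resp-≈      = subst (λ j → _ ≺[ Q ] j) , subst (λ i → i ≺[ Q ] _)
  }

source-minimal : ∀ (Q : Quiver n) {k} → IsSource Q k → ∀ {j} → ¬ j ≺[ Q ] k
source-minimal Q src p = src _ (proj₂ (last-step p))

-- h i counts flips at i; an arc i → j is reversed exactly when its source
-- has been flipped once more than its target.
Turns : Rel A 0ℓ → (A → ℕ) → Rel A 0ℓ
Turns S h i j = (S i j × h i ≡ h j) ⊎ (S j i × h i ≡ suc (h j))

-- The target is an arbitrary relation, so that one notion serves for the arcs of another quiver,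
-- for a linear order and for the reachability order of a quiver.
Height : Quiver n → Rel (Fin n) 0ℓ → (Fin n → ℕ) → Set
Height Q S h = ∀ {i j} → i ⟶[ Q ] j → Turns S h i j

Extends : Quiver n → Rel (Fin n) 0ℓ → Set
Extends Q S = ∃[ h ] Height Q S h

height-trans : ∀ {Q Q′ : Quiver n} {S : Rel (Fin n) 0ℓ} {g h} →
               Height Q (arrow Q′) g → Height Q′ S h → Height Q S (λ i → g i + h i)
height-trans {g = g} {h} G H {i} {j} r with G r
... | inj₁ (s , e) with H s
...   | inj₁ (t , e′) = inj₁ (t , cong₂ _+_ e e′)
...   | inj₂ (t , e′) = inj₂ (t , trans (cong₂ _+_ e e′) (ℕₚ.+-suc (g j) (h j)))
height-trans {g = g} {h} G H {i} {j} r | inj₂ (s , e) with H s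
...   | inj₁ (t , e′) = inj₂ (t , cong₂ _+_ e (sym e′))
-- An arc reversed twice is back in place: the first height is one larger at `i`, the second one
-- larger at `j`, and the sums agree.
...   | inj₂ (t , e′) = inj₁ (t , trans (cong (_+ h i) e) (trans (sym (ℕₚ.+-suc (g j) (h i))) (cong (g j +_) (sym e′))))

extends-trans : ∀ {Q Q′ : Quiver n} {S : Rel (Fin n) 0ℓ} →
                Extends Q (arrow Q′) → Extends Q′ S → Extends Q S
extends-trans {Q = Q} {Q′} (g , G) (h , H) = _ , height-trans {Q = Q} {Q′} {g = g} {h} G H

height-≥ : ∀ {Q : Quiver n} {S : Rel (Fin n) 0ℓ} {h} → Height Q S h →
           ∀ {i j} → Star (arrow Q) i j → h j ℕ.≤ h i
height-≥ H ε = ℕₚ.≤-refl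
height-≥ {Q = Q} H (r ◅ p) with H r
... | inj₁ (_ , e) = ℕₚ.≤-trans (height-≥ {Q = Q} H p) (ℕₚ.≤-reflexive (sym e))
... | inj₂ (_ , e) = ℕₚ.≤-trans (height-≥ {Q = Q} H p) (ℕₚ.≤-trans (ℕₚ.n≤1+n _) (ℕₚ.≤-reflexive (sym e)))

-- Heights never rise along a directed path, so equal heights at its ends force equality across
-- every arc, and no arc of the path is reversed.
height-level : ∀ {Q : Quiver n} {S : Rel (Fin n) 0ℓ} {h} → Height Q S h →
               ∀ {i j} → i ≺[ Q ] j → h i ≡ h j → TransClosure S i j
height-level H [ r ] lvl with H r
... | inj₁ (s , _) = [ s ]
... | inj₂ (_ , e) = contradiction (trans (sym e) lvl) (ℕₚ.1+n≢n)
height-level {Q = Q} H (r ∷ p) lvl with H r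
... | inj₁ (s , e) = s ∷ height-level {Q = Q} H p (trans (sym e) lvl)
... | inj₂ (_ , e) = contradiction
  (ℕₚ.≤-trans (ℕₚ.≤-reflexive (trans (sym e) lvl)) (height-≥ {Q = Q} H (plus⇒star p))) ℕₚ.1+n≰n

-- Flipping along a height function

module _ (Q : Quiver n) (h : Fin n → ℕ)
         (drop : ∀ {i j} → i ⟶[ Q ] j → h i ≡ h j ⊎ h i ≡ suc (h j)) where

  Flipped : Rel (Fin n) 0ℓ
  Flipped i j = (i ⟶[ Q ] j × h i ≡ h j) ⊎ (j ⟶[ Q ] i × h j ≡ suc (h i))

  flipped-≤ : ∀ {i j} → TransClosure Flipped i j → h i ℕ.≤ h j
  flipped-≤ [ r ]   = step r
    where
    step : ∀ {i j} → Flipped i j → h i ℕ.≤ h j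
    step (inj₁ (_ , e)) = ℕₚ.≤-reflexive e
    step (inj₂ (_ , e)) = ℕₚ.≤-trans (ℕₚ.n≤1+n _) (ℕₚ.≤-reflexive (sym e))
  flipped-≤ (r ∷ p) = ℕₚ.≤-trans (flipped-≤ [ r ]) (flipped-≤ p)

  -- Heights never fall along `Flipped`, and a reversed arc strictly raises them. Hence a level path
  -- uses unreversed arcs of `Q` alone; in particular a cycle of `Flipped` would be a cycle of `Q`.
  flipped-level : ∀ {i j} → TransClosure Flipped i j → h i ≡ h j → i ≺[ Q ] j
  flipped-level [ inj₁ (r , _) ] _   = [ r ]
  flipped-level [ inj₂ (_ , e) ] lvl = contradiction (trans (sym e) (sym lvl)) ℕₚ.1+n≢n
  flipped-level (inj₁ (r , e) ∷ p) lvl = r ∷ flipped-level p (trans (sym e) lvl)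
  flipped-level (inj₂ (_ , e) ∷ p) lvl =
    contradiction (ℕₚ.≤-trans (ℕₚ.≤-reflexive (sym e)) (ℕₚ.≤-trans (flipped-≤ p) (ℕₚ.≤-reflexive (sym lvl)))) ℕₚ.1+n≰n

  flipped? : Decidable Flipped
  flipped? i j = (Quiver._⟶?_ Q i j ×-dec h i ℕₚ.≟ h j) ⊎-dec (Quiver._⟶?_ Q j i ×-dec h j ℕₚ.≟ suc (h i))

  flipBy : Quiver n
  flipBy = fromRelation Flipped flipped? λ p → acyclic Q (flipped-level p refl)

  flipBy⁻ : ∀ {i j} → i ⟶[ flipBy ] j → Flipped i j
  flipBy⁻ = toWitness

  flipBy⁺ : ∀ {i j} → Flipped i j → i ⟶[ flipBy ] j
  flipBy⁺ = fromWitness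

  flipBy-height : Height Q (arrow flipBy) h
  flipBy-height r with drop r
  ... | inj₁ e = inj₁ (flipBy⁺ (inj₁ (r , e)) , e)
  ... | inj₂ e = inj₂ (flipBy⁺ (inj₂ (r , e)) , e)

  flipBy-adjacent : ∀ {i j} → i ⟶[ flipBy ] j → Adjacent Q i j
  flipBy-adjacent r = Sum.map proj₁ proj₁ (flipBy⁻ r)

-- Equivalence under flips

FlippedAt : (Q Q′ : Quiver n) → Fin n → Set
FlippedAt Q Q′ k = ∀ i j → arc Q′ i j ≡ (if does (i ≟ k) ∨ does (j ≟ k) then arc Q j i else arc Q i j)

flippedAt-sym : ∀ (Q Q′ : Quiver n) {k} → FlippedAt Q Q′ k → FlippedAt Q′ Q k
flippedAt-sym Q Q′ {k} eq i j with does (i ≟ k) | does (j ≟ k) | eq i j | eq j i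
... | true  | true  | _ | e = sym e
... | true  | false | _ | e = sym e
... | false | true  | _ | e = sym e
... | false | false | e | _ = sym e

-- A flip turns a source into a sink and a sink into a source, so flipping the same vertex again is
-- allowed and undoes it.
flip-sym : ∀ {Q Q′ : Quiver n} → Flip Q Q′ → Flip Q′ Q
flip-sym {Q = Q} {Q′} (k , end , eq) = k , turn end , eq′
  where
  eq′ = flippedAt-sym Q Q′ eq
  turn : IsSource Q k ⊎ IsSink Q k → IsSource Q′ k ⊎ IsSink Q′ k
  turn (inj₁ src) = inj₂ λ j r → src j (out {Q = Q′} {Q} k eq′ r)
  turn (inj₂ snk) = inj₁ λ j r → snk j (into {Q = Q′} {Q} k eq′ r)

-- Serves to absorb the `SameArcs` at the end of one sequence of flips into the first flip of the
-- next.
flip-respˡ : ∀ {P Q Q′ : Quiver n} → SameArcs P Q → Flip Q Q′ → Flip P Q′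
flip-respˡ {P = P} {Q} same (k , end , eq) =
  k , Sum.map (λ src j r → src j (subst T (same j k) r)) (λ snk j r → snk j (subst T (same k j) r)) end
    , λ i j → trans (eq i j) (cong₂ (if_then_else_ (does (i ≟ k) ∨ does (j ≟ k))) (sym (same j i)) (sym (same i j)))

∼-trans : ∀ (P Q R : Quiver n) → P ∼ Q → Q ∼ R → P ∼ R
∼-trans P Q R (A , fs , same) (B , ε , same′) = A , fs , λ i j → trans (same i j) (same′ i j)
∼-trans P Q R (A , fs , same) (B , _◅_ {j = C} g gs , same′) =
  B , fs ◅◅ (flip-respˡ {P = A} {Q} {C} same g ◅ gs) , same′

∼-sym : ∀ (P Q : Quiver n) → P ∼ Q → Q ∼ P
∼-sym P Q (A , ε , same) = Q , ε , λ i j → sym (same i j)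
∼-sym P Q (A , _◅_ {j = B} f fs , same) =
  let C , gs , same′ = ∼-sym B Q (A , fs , same)
  in P , gs ◅◅ (flip-respˡ {P = C} {B} {P} same′ (flip-sym {Q = P} {B} f) ◅ ε) , λ _ _ → refl

bump : Fin n → Fin n → ℕ
bump k i = indicator (i ≟ k)

bump-self : ∀ (k : Fin n) → bump k k ≡ 1
bump-self k = indicator-yes (k ≟ k) refl

bump-other : ∀ {k i : Fin n} → i ≢ k → bump k i ≡ 0
bump-other {k = k} {i} = indicator-no (i ≟ k)

flip⇒extends : ∀ {Q Q′ : Quiver n} → Flip Q Q′ → Extends Q (arrow Q′)
flip⇒extends {Q = Q} {Q′} (k , inj₁ src , eq) = bump k , H
  where
  H : Height Q (arrow Q′) (bump k)
  H {i} {j} r with i ≟ k | j ≟ k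
  ... | _        | yes refl = contradiction r (src i)
  ... | yes refl | no _     = inj₂ (out {Q = Q} {Q′} k eq r , refl)
  ... | no i≢k   | no j≢k   = inj₁ (away {Q = Q} {Q′} k eq i≢k j≢k r , refl)
-- Flipping a sink amounts to lowering it by one; to stay in ℕ, all other vertices are raised by one
-- instead.
flip⇒extends {Q = Q} {Q′} (k , inj₂ snk , eq) = (λ i → 1 ∸ bump k i) , H
  where
  H : Height Q (arrow Q′) (λ i → 1 ∸ bump k i)
  H {i} {j} r with i ≟ k | j ≟ k
  ... | yes refl | _        = contradiction r (snk j)
  ... | no _     | yes refl = inj₂ (into {Q = Q} {Q′} k eq r , refl)
  ... | no i≢k   | no j≢k   = inj₁ (away {Q = Q} {Q′} k eq i≢k j≢k r , refl)

extends-mono : ∀ {Q : Quiver n} {S S′ : Rel (Fin n) 0ℓ} → (∀ {i j} → S i j → S′ i j) → Extends Q S → Extends Q S′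
extends-mono f (h , H) = h , λ r → Sum.map (λ (s , e) → f s , e) (λ (s , e) → f s , e) (H r)

extends-refl : ∀ {Q : Quiver n} → Extends Q (arrow Q)
extends-refl = (λ _ → 0) , λ r → inj₁ (r , refl)

∼⇒extends : ∀ {Q Q′ : Quiver n} → Q ∼ Q′ → Extends Q (arrow Q′)
∼⇒extends {Q = Q} {Q′} (A , ε , same) =
  extends-mono {Q = Q} (λ {i} {j} → subst T (same i j)) (extends-refl {Q = Q})
∼⇒extends {Q = Q} {Q′} (A , _◅_ {j = B} f fs , same) =
  extends-trans {Q = Q} {B} (flip⇒extends {Q = Q} {B} f) (∼⇒extends {Q = B} {Q′} (A , fs , same))

extends⇒adjacent : ∀ {Q : Quiver n} {S} → Extends Q S → ∀ {i j} → Adjacent Q i j → S i j ⊎ S j i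
extends⇒adjacent (h , H) (inj₁ r) = Sum.map proj₁ proj₁ (H r)
extends⇒adjacent (h , H) (inj₂ r) = Sum.swap (Sum.map proj₁ proj₁ (H r))

∼⇒adjacent : ∀ {Q Q′ : Quiver n} → Q ∼ Q′ → ∀ {i j} → Adjacent Q i j → Adjacent Q′ i j
∼⇒adjacent {Q = Q} {Q′} e = extends⇒adjacent {Q = Q} (∼⇒extends {Q = Q} {Q′} e)

-- Realising a height function by flips at sources

total : (Fin n → ℕ) → ℕ
total {zero}  h = 0
total {suc n} h = h zero + total (h ∘ suc)

total-≤ : ∀ {g h : Fin n → ℕ} → (∀ i → g i ℕ.≤ h i) → total g ℕ.≤ total h
total-≤ {zero}  le = z≤n
total-≤ {suc n} le = ℕₚ.+-mono-≤ (le zero) (total-≤ (le ∘ suc))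

total-< : ∀ {g h : Fin n → ℕ} → (∀ i → g i ℕ.≤ h i) → ∀ k → g k ℕ.< h k → total g ℕ.< total h
total-< le zero    lt = ℕₚ.+-mono-<-≤ lt (total-≤ (le ∘ suc))
total-< le (suc k) lt = ℕₚ.+-mono-≤-< (le zero) (total-< (le ∘ suc) k lt)

source-above : ∀ (Q : Quiver n) k → ∃[ s ] IsSource Q s × Star (arrow Q) s k
source-above Q k = go k (≺-wellFounded Q k)
  where
  go : ∀ k → Acc (reach Q) k → ∃[ s ] IsSource Q s × Star (arrow Q) s k
  go k (acc rec) with any? (λ j → Quiver._⟶?_ Q j k)
  ... | no ¬p       = k , (λ j r → ¬p (j , r)) , ε
  ... | yes (j , r) = let s , src , p = go j (rec [ r ]) in s , src , p ◅◅ (r ◅ ε)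

module _ (Q : Quiver n) {k : Fin n} (src : IsSource Q k) where

  private
    drop : ∀ {i j} → i ⟶[ Q ] j → bump k i ≡ bump k j ⊎ bump k i ≡ suc (bump k j)
    drop {i} {j} r with i ≟ k | j ≟ k
    ... | _        | yes refl = contradiction r (src i)
    ... | yes refl | no _     = inj₂ refl
    ... | no _     | no _     = inj₁ refl

  flipAt : Quiver n
  flipAt = flipBy Q (bump k) drop

  flipAt-flip : Flip Q flipAt
  flipAt-flip = k , inj₁ src , λ i j → T-injective (to i j) (from i j)
    where
    to : ∀ i j → i ⟶[ flipAt ] j → T (if does (i ≟ k) ∨ does (j ≟ k) then arc Q j i else arc Q i j)
    to i j r with flipBy⁻ Q (bump k) drop r
    to i j r | p with i ≟ k | j ≟ k
    to i j r | inj₁ (s , _) | yes refl | yes refl = s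
    to i j r | inj₂ (s , _) | yes refl | yes refl = s
    to i j r | inj₁ (s , _) | no _     | no _     = s
    to i j r | inj₂ (s , _) | no _     | yes refl = s
    cases : ∀ i j → T (if does (i ≟ k) ∨ does (j ≟ k) then arc Q j i else arc Q i j) →
            (i ≢ k × j ≡ k × j ⟶[ Q ] i) ⊎ (i ≢ k × j ≢ k × i ⟶[ Q ] j)
    cases i j s with i ≟ k | j ≟ k
    ... | yes refl | _        = contradiction s (src j)
    ... | no i≢k   | yes refl = inj₁ (i≢k , refl , s)
    ... | no i≢k   | no j≢k   = inj₂ (i≢k , j≢k , s)
    from : ∀ i j → T (if does (i ≟ k) ∨ does (j ≟ k) then arc Q j i else arc Q i j) → i ⟶[ flipAt ] j
    from i j s with cases i j s
    ... | inj₁ (i≢k , refl , r) = flipBy⁺ Q (bump k) drop (inj₂ (r , trans (bump-self k) (cong suc (sym (bump-other i≢k)))))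
    ... | inj₂ (i≢k , j≢k , r)  = flipBy⁺ Q (bump k) drop (inj₁ (r , trans (bump-other i≢k) (sym (bump-other j≢k))))

  -- The flip at `k` uses up one of the flips that `h` prescribes there; what remains of `h` still
  -- leads to `S`.
  flipAt-height : ∀ {S h} → Height Q S h → 1 ℕ.≤ h k → Height flipAt S (λ i → h i ∸ bump k i)
  flipAt-height {S} {h} H pos {i} {j} r with flipBy⁻ Q (bump k) drop r
  ... | p with i ≟ k | j ≟ k
  flipAt-height {S} {h} H pos {i} {j} r | inj₁ (s , _) | yes refl | yes refl = contradiction s (src i)
  flipAt-height {S} {h} H pos {i} {j} r | inj₁ (s , _) | no _     | no _     = H s
  flipAt-height {S} {h} H pos {i} {j} r | inj₂ (s , _) | yes refl | yes refl = contradiction s (src i)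
  flipAt-height {S} {h} H pos {i} {j} r | inj₂ (s , _) | no _     | yes refl with H s
  ... | inj₁ (t , e) = inj₂ (t , trans (sym e) (sym (ℕₚ.m+[n∸m]≡n pos)))
  ... | inj₂ (t , e) = inj₁ (t , sym (cong ℕ.pred e))

-- Induction on the sum of the heights. A vertex of positive height lies below some source, whose
-- height is at least as large since heights never rise along arcs; flipping that source decreases
-- the sum. Once all heights vanish no arc is reversed, and the hypothesis on adjacency leaves `Q′`
-- no further arcs.
extends⇒∼ : ∀ {Q Q′ : Quiver n} → (∀ {i j} → i ⟶[ Q′ ] j → Adjacent Q i j) → Extends Q (arrow Q′) → Q ∼ Q′
extends⇒∼ {Q = Q} {Q′} adj (h , H) = go Q h adj H (<-wellFounded _)
  where
  go : ∀ Q h → (∀ {i j} → i ⟶[ Q′ ] j → Adjacent Q i j) → Height Q (arrow Q′) h →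
       Acc ℕ._<_ (total h) → Q ∼ Q′
  go Q h adj H (acc rec) with any? (λ k → 1 ℕₚ.≤? h k)
  ... | no ¬p = Q , ε , λ i j → T-injective to from
    where
    to : ∀ {i j} → i ⟶[ Q ] j → i ⟶[ Q′ ] j
    to {i} r with H r
    ... | inj₁ (s , _) = s
    ... | inj₂ (_ , e) = contradiction (i , subst (1 ℕ.≤_) (sym e) (s≤s z≤n)) ¬p
    from : ∀ {i j} → i ⟶[ Q′ ] j → i ⟶[ Q ] j
    from r with adj r
    ... | inj₁ s = s
    ... | inj₂ s = contradiction (to s) (arc-asym Q′ r)
  ... | yes (k , pos) with source-above Q k
  ...   | s , src , p =
    let flp = flipAt-flip Q src
        pos′ = ℕₚ.≤-trans pos (height-≥ {Q = Q} H p)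
        B , fs , same = go (flipAt Q src) (λ i → h i ∸ bump s i)
          (λ r → ∼⇒adjacent {Q = Q} {flipAt Q src} (flipAt Q src , flp ◅ ε , λ _ _ → refl) (adj r))
          (flipAt-height Q src {S = arrow Q′} {h} H pos′)
          (rec (total-< (λ i → ℕₚ.m∸n≤m (h i) (bump s i)) s
            (subst (λ x → h s ∸ x ℕ.< h s) (sym (bump-self s)) (ℕₚ.≤-reflexive (ℕₚ.m+[n∸m]≡n pos′)))))
    in B , flp ◅ fs , same

-- Toric directed paths

nodes : ∀ {R : Rel A 0ℓ} {i j} → Star R i j → List A
nodes {i = i} ε       = i ∷ []
nodes {i = i} (r ◅ p) = i ∷ nodes p

module _ {R : Rel A 0ℓ} where

  start∈nodes : ∀ {i j} (p : Star R i j) → i ∈ nodes p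
  start∈nodes ε       = here refl
  start∈nodes (r ◅ p) = here refl

  ∈-nodes-◅◅ : ∀ {i j k} (p : Star R i j) (q : Star R j k) {x} → x ∈ nodes q → x ∈ nodes (p ◅◅ q)
  ∈-nodes-◅◅ ε       q x∈ = x∈
  ∈-nodes-◅◅ (r ◅ p) q x∈ = there (∈-nodes-◅◅ p q x∈)

  nodes-linked : ∀ {i j} (p : Star R i j) → Linked R (nodes p)
  nodes-linked ε             = [-]
  nodes-linked (r ◅ ε)       = r ∷ [-]
  nodes-linked (r ◅ (s ◅ p)) = r ∷ nodes-linked (s ◅ p)

  nodes-∷ʳ : ∀ {i j} (p : Star R i j) → ∃[ xs ] nodes p ≡ xs ∷ʳ j
  nodes-∷ʳ ε       = [] , refl
  nodes-∷ʳ (r ◅ p) = let xs , e = nodes-∷ʳ p in _ ∷ xs , cong (_ ∷_) e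

linked-unique : ∀ (Q : Quiver n) {xs} → Linked (arrow Q) xs → Unique xs
linked-unique Q []      = []
linked-unique Q [-]     = [] ∷ []
linked-unique Q (r ∷ l) =
  All.tabulate (λ { j∈ refl → acyclic Q (linked-∈ {Q = Q} (r ∷ l) j∈) }) ∷ linked-unique Q l

linked-∷ʳ : ∀ (Q : Quiver n) xs {z j} → Linked (arrow Q) (xs ∷ʳ z) → j ∈ xs ∷ʳ z → Star (arrow Q) j z
linked-∷ʳ Q []       l (here refl) = ε
linked-∷ʳ Q (x ∷ xs) l (here refl) = plus⇒star (linked-∈ {Q = Q} l (∈-++⁺ʳ xs (here refl)))
linked-∷ʳ Q (x ∷ xs) l (there j∈)  = linked-∷ʳ Q xs (Linked.tail l) j∈

linked-head : ∀ (Q : Quiver n) {y ys j} → Linked (arrow Q) (y ∷ ys) → j ∈ y ∷ ys → Star (arrow Q) y j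
linked-head Q l (here refl) = ε
linked-head Q l (there j∈)  = plus⇒star (linked-∈ {Q = Q} l j∈)

-- A form of `PathArc` without lists: a directed path from `y` through `i` and then `j` to `z`,
-- closed by an arc. The distinctness of its vertices comes from acyclicity.
Bypassed : Quiver n → Rel (Fin n) 0ℓ
Bypassed Q i j = i ≺[ Q ] j × ∃[ y ] ∃[ z ] Star (arrow Q) y i × Star (arrow Q) j z × y ⟶[ Q ] z

pathArc⇒bypassed : ∀ (Q : Quiver n) {i j} → PathArc Q i j → Bypassed Q i j
pathArc⇒bypassed Q (_ , single y , here ())
pathArc⇒bypassed Q (_ , single y , there ())
pathArc⇒bypassed Q (_ , closed {y} {zs} {z} un l c , pre) =
  linked-precedes {Q = Q} l pre , y , z ,
  linked-head Q l (precedes-∈ˡ pre) , linked-∷ʳ Q (y ∷ zs) l (precedes-∈ʳ pre) , c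

bypassed⇒pathArc : ∀ (Q : Quiver n) {i j} → Bypassed Q i j → PathArc Q i j
bypassed⇒pathArc {n} Q {i} {j} (i≺j , y , z , p , q , c) = result path (start∈nodes path) i∈ j∈
  where
  path : Star (arrow Q) y z
  path = p ◅◅ (plus⇒star i≺j ◅◅ q)
  i∈ : i ∈ nodes path
  i∈ = ∈-nodes-◅◅ p _ (start∈nodes (plus⇒star i≺j ◅◅ q))
  j∈ : j ∈ nodes path
  j∈ = ∈-nodes-◅◅ p _ (∈-nodes-◅◅ (plus⇒star i≺j) q (start∈nodes q))
  ordered : ∀ {xs} → Linked (arrow Q) xs → i ∈ xs → j ∈ xs → Precedes i j xs
  ordered l i∈ j∈ with ∈-precedes i∈ j∈
  ... | inj₁ refl       = contradiction i≺j (acyclic Q)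
  ... | inj₂ (inj₁ pre) = pre
  ... | inj₂ (inj₂ pre) = contradiction (linked-precedes {Q = Q} l pre ++⁺ i≺j) (acyclic Q)
  result : (path : Star (arrow Q) y z) → y ∈ nodes path → i ∈ nodes path → j ∈ nodes path → PathArc Q i j
  result ε       _ _  _  = contradiction [ c ] (acyclic Q)
  result (r ◅ p) _ i∈ j∈ with nodes p | nodes-∷ʳ p | nodes-linked (r ◅ p)
  ... | _ | xs , refl | l = y ∷ xs ∷ʳ z , closed {zs = xs} (linked-unique Q l) l c , ordered l i∈ j∈

-- The closing arc `y ⟶ z` bounds the drop of the height from `y` to `z` by one. If `h i ≡ h j`, the
-- stretch from `i` to `j` is level, so it keeps its direction in `S`, and transitivity contracts it
-- to a single pair.
height-pathArc : ∀ {Q : Quiver n} {S : Rel (Fin n) 0ℓ} {h} → Transitive S → Height Q S h →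
                 ∀ {i j} → PathArc Q i j → Turns S h i j
height-pathArc {Q = Q} {S} {h} tr H {i} {j} pa with pathArc⇒bypassed Q pa
... | i≺j , y , z , p , q , c = result (H c) (h i ℕₚ.≟ h j)
  where
  y≥i = height-≥ {Q = Q} H p
  i≥j = height-≥ {Q = Q} H (plus⇒star i≺j)
  j≥z = height-≥ {Q = Q} H q
  collapse : ∀ {i j} → TransClosure S i j → S i j
  collapse [ s ]   = s
  collapse (s ∷ p) = tr s (collapse p)
  level : ∀ {i j} → Star (arrow Q) i j → h i ≡ h j → i ≡ j ⊎ S i j
  level p e = Sum.map₂ (λ p → collapse (height-level {Q = Q} H p e)) (star⇒plus p)
  before-eq : ∀ {a b c} → S a b → b ≡ c ⊎ S b c → S a c
  before-eq s (inj₁ refl) = s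
  before-eq s (inj₂ t)    = tr s t
  eq-before : ∀ {a b c} → a ≡ b ⊎ S a b → S b c → S a c
  eq-before (inj₁ refl) t = t
  eq-before (inj₂ s)    t = tr s t
  result : Turns S h y z → Dec (h i ≡ h j) → Turns S h i j
  result _ (yes e) = inj₁ (collapse (height-level {Q = Q} H i≺j e) , e)
  result (inj₁ (_ , e)) (no i≢j) =
    contradiction (ℕₚ.≤-antisym (ℕₚ.≤-trans y≥i (ℕₚ.≤-trans (ℕₚ.≤-reflexive e) j≥z)) i≥j) i≢j
  -- The one drop lies between `i` and `j`, so the stretches from `y` to `i` and from `j` to `z` are
  -- level. Hence `S` leads from `j` to `z`, by the reversed closing arc to `y`, and on to `i`.
  result (inj₂ (s , e)) (no i≢j) =
    inj₂ (before-eq (eq-before (level q j≡z) s) (level p (trans e (sym i≡z+1))) , trans i≡z+1 (cong suc (sym j≡z)))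
    where
    j<i = ℕₚ.≤∧≢⇒< i≥j (i≢j ∘ sym)
    i≤z+1 = ℕₚ.≤-trans y≥i (ℕₚ.≤-reflexive e)
    j≡z : h j ≡ h z
    j≡z = ℕₚ.≤-antisym (ℕₚ.≤-pred (ℕₚ.≤-trans j<i i≤z+1)) j≥z
    i≡z+1 : h i ≡ suc (h z)
    i≡z+1 = ℕₚ.≤-antisym i≤z+1 (ℕₚ.≤-trans (s≤s j≥z) j<i)

-- Comparability and the toric transitive closure

module _ (Q : Quiver n) (v : Fin n) where

  private
    below? : ∀ u → Dec (u ≺[ Q ] v)
    below? u = plus? (Quiver._⟶?_ Q) u v

    h : Fin n → ℕ
    h u = indicator (below? u)

    h-v : h v ≡ 0
    h-v = indicator-no (below? v) (acyclic Q)

    drop : ∀ {i j} → i ⟶[ Q ] j → h i ≡ h j ⊎ h i ≡ suc (h j)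
    drop {i} {j} r with below? i | below? j
    ... | yes _  | yes _ = inj₁ refl
    ... | yes _  | no _  = inj₂ refl
    ... | no i⊀v | yes p = contradiction (r ∷ p) i⊀v
    ... | no _   | no _  = inj₁ refl

  -- Every strict ancestor of `v` is flipped once. Predecessors of ancestors are ancestors, so the
  -- indicator of this set drops by at most one along an arc and never rises; all arcs into `v` are
  -- reversed.
  raise : Quiver n
  raise = flipBy Q h drop

  raise-∼ : Q ∼ raise
  raise-∼ = extends⇒∼ {Q = Q} {raise} (flipBy-adjacent Q h drop) (h , flipBy-height Q h drop)

  raise-source : IsSource raise v
  raise-source j r with flipBy⁻ Q h drop r
  ... | inj₁ (s , e) = contradiction (trans (sym (indicator-yes (below? j) [ s ])) (trans e h-v)) λ ()
  ... | inj₂ (_ , e) = contradiction (trans (sym h-v) e) λ ()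

  raise-keeps-source : ∀ {u} → IsSource Q u → ¬ u ≺[ Q ] v → IsSource raise u
  raise-keeps-source {u} src u⊀v j r with flipBy⁻ Q h drop r
  ... | inj₁ (s , _) = src j s
  ... | inj₂ (_ , e) = contradiction (trans (sym (indicator-no (below? u) u⊀v)) e) λ ()

  -- Along a path of `raise` the heights never fall, and here they go from 0 up to 1 at `a`. The
  -- rise happens on the last arc, since a level stretch ending in `a` would be a path of `Q` into a
  -- source. So the path follows `Q` up to some `x` and then reverses an arc from `a` to `x`, which
  -- closes a toric directed path in `raise-bypass`.
  raise-path : ∀ {a} → IsSource Q a → a ≺[ Q ] v → ∀ {i} → h i ≡ 0 → i ≺[ raise ] a →
               ∃[ x ] Star (arrow Q) i x × a ⟶[ Q ] x
  raise-path {a} src a≺v hi [ r ] with flipBy⁻ Q h drop r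
  ... | inj₁ (s , _) = contradiction s (src _)
  ... | inj₂ (s , _) = _ , ε , s
  raise-path {a} src a≺v hi (r ∷ p) with flipBy⁻ Q h drop r
  ... | inj₁ (s , e) = let x , q , t = raise-path src a≺v (trans (sym e) hi) p in x , s ◅ q , t
  ... | inj₂ (_ , e) = contradiction
    (flipped-level Q h drop (mapPath (flipBy⁻ Q h drop) p)
      (trans e (trans (cong suc hi) (sym (indicator-yes (below? a) a≺v)))))
    (source-minimal Q src)

  raise-bypass : ∀ {a} → IsSource Q a → a ≺[ Q ] v → v ≺[ raise ] a → Bypassed Q a v
  raise-bypass src a≺v p = let x , q , t = raise-path src a≺v h-v p in a≺v , _ , x , ε , q , t

-- a is raised to a source, then b; only if this pushes a above b again is a
-- raised a second time.
sources-or-pathArc : ∀ (Q : Quiver n) a b →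
  (∃[ P ] Q ∼ P × IsSource P a × IsSource P b) ⊎ (∃[ P ] Q ∼ P × PathArc P a b)
sources-or-pathArc Q a b with plus? (Quiver._⟶?_ (raise Q a)) a b
... | no a⊀b  = inj₁ (raise (raise Q a) b , ∼-trans Q (raise Q a) (raise (raise Q a) b) (raise-∼ Q a) (raise-∼ (raise Q a) b)
                     , raise-keeps-source (raise Q a) b (raise-source Q a) a⊀b , raise-source (raise Q a) b)
... | yes a≺b with plus? (Quiver._⟶?_ (raise (raise Q a) b)) b a
...   | yes b≺a = inj₂ (raise Q a , raise-∼ Q a
                       , bypassed⇒pathArc (raise Q a) (raise-bypass (raise Q a) b (raise-source Q a) a≺b b≺a))
...   | no b⊀a  = inj₁ (raise Q₂ a
                       , ∼-trans Q (raise Q a) (raise Q₂ a) (raise-∼ Q a)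
                           (∼-trans (raise Q a) Q₂ (raise Q₂ a) (raise-∼ (raise Q a) b) (raise-∼ Q₂ a))
                       , raise-source Q₂ a , raise-keeps-source Q₂ a (raise-source (raise Q a) b) b⊀a)
  where Q₂ = raise (raise Q a) b

comparable-sym : ∀ {Q : Quiver n} {i j} → Comparable Q i j → Comparable Q j i
comparable-sym (S , chain , i∈ , j∈) = S , chain , j∈ , i∈

comparable-resp-∼ : ∀ {P Q : Quiver n} → P ∼ Q → ∀ {i j} → Comparable P i j → Comparable Q i j
comparable-resp-∼ {P = P} {Q} e (S , chain , i∈ , j∈) =
  S , (λ Q′ e′ → chain Q′ (∼-trans P Q Q′ e e′)) , i∈ , j∈

comparable-refl : ∀ {Q : Quiver n} i → Comparable Q i i
comparable-refl i = ⁅ i ⁆ , chain , x∈⁅x⁆ i , x∈⁅x⁆ i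
  where
  chain : ToricChain _ ⁅ i ⁆
  chain _ _ k l k∈ l∈ = inj₁ (trans (x∈⁅y⁆⇒x≡y i k∈) (sym (x∈⁅y⁆⇒x≡y i l∈)))

toricPath-resp-≡ : ∀ {P Q : Quiver n} → SameArcs P Q → ∀ {ys} → ToricPath P ys → ToricPath Q ys
toricPath-resp-≡ same (single y) = single y
toricPath-resp-≡ same (closed {y} {zs} {z} un l c) =
  closed {zs = zs} un (Linked.map (λ {i} {j} → subst T (same i j)) l) (subst T (same y z) c)

-- Flips rotate a toric directed path, so its elements stay on a common one but may change their
-- order.
pathArc-resp-∼ : ∀ {P Q : Quiver n} → P ∼ Q → ∀ {i j} → i ≢ j → PathArc P i j → PathArc Q i j ⊎ PathArc Q j i
pathArc-resp-∼ {P = P} {Q} (A , fs , same) i≢j (ys , t , pre) with flips-path fs t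
... | zs , t′ , sub with toricPath-resp-≡ {P = A} {Q} same t′ | ∈-precedes (sub (precedes-∈ˡ pre)) (sub (precedes-∈ʳ pre))
...   | _  | inj₁ i≡j        = contradiction i≡j i≢j
...   | t″ | inj₂ (inj₁ pre) = inj₁ (zs , t″ , pre)
...   | t″ | inj₂ (inj₂ pre) = inj₂ (zs , t″ , pre)

sources⇒incomparable : ∀ {P Q : Quiver n} → P ∼ Q → ∀ {i j} → i ≢ j → IsSource Q i → IsSource Q j → Incomparable P i j
sources⇒incomparable {Q = Q} e i≢j si sj (S , chain , i∈ , j∈) with chain Q e _ _ i∈ j∈
... | inj₁ i≡j        = i≢j i≡j
... | inj₂ (inj₁ i≺j) = source-minimal Q sj i≺j
... | inj₂ (inj₂ j≺i) = source-minimal Q si j≺i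

-- The characterisation of toric chains by toric directed paths, for pairs. Comparability rules out
-- a member of the class with both elements as sources, so some member has a toric directed path
-- through them, and this is carried back to `Q`.
comparable⇒pathArc : ∀ {Q : Quiver n} {i j} → i ≢ j → Comparable Q i j → PathArc Q i j ⊎ PathArc Q j i
comparable⇒pathArc {Q = Q} {i} {j} i≢j cmp with sources-or-pathArc Q i j
... | inj₁ (P , e , si , sj) = contradiction cmp (sources⇒incomparable {P = Q} {P} e i≢j si sj)
... | inj₂ (P , e , pa)      = pathArc-resp-∼ {P = P} {Q} (∼-sym Q P e) i≢j pa

arc⇒pathArc : ∀ {Q : Quiver n} {i j} → i ⟶[ Q ] j → PathArc Q i j
arc⇒pathArc {Q = Q} r = bypassed⇒pathArc Q ([ r ] , _ , _ , ε , ε , r)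

closure⁺ : ∀ {Q : Quiver n} {i j} → ClosureArc Q i j → i ⟶[ closure Q ] j
closure⁺ = fromWitness

closure⁻ : ∀ {Q : Quiver n} {i j} → i ⟶[ closure Q ] j → ClosureArc Q i j
closure⁻ = toWitness

closure⇒pathArc : ∀ {Q : Quiver n} {i j} → i ⟶[ closure Q ] j → PathArc Q i j
closure⇒pathArc {Q = Q} r with closure⁻ {Q = Q} r
... | inj₁ s        = arc⇒pathArc {Q = Q} s
... | inj₂ (_ , pa) = pa

pathArc⇒closure : ∀ {Q : Quiver n} {i j} → PathArc Q i j → i ⟶[ closure Q ] j
pathArc⇒closure {Q = Q} pa = closure⁺ {Q = Q} (inj₂ (pathArc⇒comparable pa , pa))

comparable⇒adjacent : ∀ {Q : Quiver n} {i j} → i ≢ j → Comparable Q i j → Adjacent (closure Q) i j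
comparable⇒adjacent {Q = Q} i≢j cmp =
  Sum.map (pathArc⇒closure {Q = Q}) (pathArc⇒closure {Q = Q}) (comparable⇒pathArc {Q = Q} i≢j cmp)

adjacent⇒comparable : ∀ {Q : Quiver n} {i j} → Adjacent (closure Q) i j → Comparable Q i j
adjacent⇒comparable {Q = Q} (inj₁ r) = pathArc⇒comparable (closure⇒pathArc {Q = Q} r)
adjacent⇒comparable {Q = Q} (inj₂ r) = comparable-sym {Q = Q} (pathArc⇒comparable (closure⇒pathArc {Q = Q} r))

incomparable⇒≢ : ∀ {Q : Quiver n} {i j} → Incomparable Q i j → i ≢ j
incomparable⇒≢ {Q = Q} inc refl = inc (comparable-refl {Q = Q} _)

height-closure : ∀ {Q : Quiver n} {S : Rel (Fin n) 0ℓ} {h} → Transitive S → Height Q S h → Height (closure Q) S h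
height-closure {Q = Q} {S} tr H r = height-pathArc {Q = Q} {S} tr H (closure⇒pathArc {Q = Q} r)

extends-closure : ∀ {Q : Quiver n} {S : Rel (Fin n) 0ℓ} → Transitive S → Extends Q S → Extends (closure Q) S
extends-closure {Q = Q} tr (h , H) = h , height-closure {Q = Q} tr H

closure-extends : ∀ {Q : Quiver n} {S : Rel (Fin n) 0ℓ} → Extends (closure Q) S → Extends Q S
closure-extends {Q = Q} (h , H) = h , λ r → H (closure⁺ {Q = Q} (inj₁ r))

-- Idempotence of the closure: the order of a member of [Q] in which i and j
-- are both sources is a transitive relation that extends P as well.
incomparable⇒¬pathArc : ∀ {P Q : Quiver n} → P ∼ closure Q → ∀ {i j} → Incomparable Q i j → ¬ PathArc P i j
incomparable⇒¬pathArc {P = P} {Q} e {i} {j} inc pa with sources-or-pathArc Q i j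
... | inj₂ (R , e′ , pa′) = inc (comparable-resp-∼ {P = R} {Q} (∼-sym Q R e′) (pathArc⇒comparable pa′))
... | inj₁ (R , e′ , si , sj) with ext
  where
  ext : Extends P (reach R)
  ext = extends-trans {Q = P} {closure Q} (∼⇒extends {Q = P} {closure Q} e)
          (extends-closure {Q = Q} _++⁺_ (extends-mono {Q = Q} [_] (∼⇒extends {Q = Q} {R} e′)))
...   | h , H with height-pathArc {Q = P} {reach R} _++⁺_ H pa
...     | inj₁ (p , _) = source-minimal R sj p
...     | inj₂ (p , _) = source-minimal R si p

-- The two steps

addArc⁻ : ∀ {Q : Quiver n} {a b} {ok : Addable Q a b} {i j} → i ⟶[ addArc Q a b ok ] j → ExtendedArc Q a b i j
addArc⁻ = toWitness

addArc⁺ : ∀ {Q : Quiver n} {a b} {ok : Addable Q a b} {i j} → ExtendedArc Q a b i j → i ⟶[ addArc Q a b ok ] j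
addArc⁺ = fromWitness

addable : ∀ {Q : Quiver n} {a b} → a ≢ b → ¬ Adjacent Q a b → ¬ b ≺[ Q ] a → Addable Q a b
addable {Q = Q} {a} {b} a≢b ¬adj b⊀a = record { nonadjacent = ¬adj ; acyclic = cycle ∘ split }
  where
  -- A path that uses the new arc, perhaps repeatedly, is remembered by its part before the first
  -- use and its part after the last.
  split : ∀ {i j} → TransClosure (ExtendedArc Q a b) i j → i ≺[ Q ] j ⊎ (Star (arrow Q) i a × Star (arrow Q) b j)
  split [ old r ] = inj₁ [ r ]
  split [ new ]   = inj₂ (ε , ε)
  split (old r ∷ p) with split p
  ... | inj₁ q       = inj₁ (r ∷ q)
  ... | inj₂ (q , s) = inj₂ (r ◅ q , s)
  split (new ∷ p) with split p
  ... | inj₁ q       = inj₂ (ε , plus⇒star q)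
  ... | inj₂ (_ , s) = inj₂ (ε , s)
  cycle : ∀ {i} → ¬ (i ≺[ Q ] i ⊎ (Star (arrow Q) i a × Star (arrow Q) b i))
  cycle (inj₁ p) = acyclic Q p
  cycle (inj₂ (p , q)) = [ a≢b ∘ sym , b⊀a ]′ (star⇒plus (q ◅◅ p))

height-addArc : ∀ {Q : Quiver n} {S : Rel (Fin n) 0ℓ} {h a b} {ok : Addable Q a b} →
                Height Q S h → Turns S h a b → Height (addArc Q a b ok) S h
height-addArc {Q = Q} {ok = ok} H t r with addArc⁻ {Q = Q} {ok = ok} r
... | old s = H s
... | new   = t

addArc-height : ∀ {Q : Quiver n} {S : Rel (Fin n) 0ℓ} {h a b} {ok : Addable Q a b} →
                Height (addArc Q a b ok) S h → Height Q S h × Turns S h a b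
addArc-height {Q = Q} {ok = ok} H = (λ r → H (addArc⁺ {Q = Q} {ok = ok} (old r))) , H (addArc⁺ {Q = Q} {ok = ok} new)

addArc-extends : ∀ {Q : Quiver n} {S : Rel (Fin n) 0ℓ} {a b} {ok : Addable Q a b} → Extends (addArc Q a b ok) S → Extends Q S
addArc-extends {Q = Q} {S} {ok = ok} (h , H) = h , proj₁ (addArc-height {Q = Q} {S} {ok = ok} H)

star⇒connected : ∀ {Q : Quiver n} {i j} → Star (Adjacent Q) i j → Connected Q i j
star⇒connected ε       = 0 , []
star⇒connected (r ◅ p) = let d , w = star⇒connected p in suc d , r ∷ w

-- Heights may be shifted on a connected component, so that the height of b
-- can be adjusted to that of a.
extends-disconnected : ∀ {Q : Quiver n} {S : Rel (Fin n) 0ℓ} {a b} {ok : Addable Q a b} →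
                       ¬ Connected Q a b → S a b ⊎ S b a → Extends Q S → Extends (addArc Q a b ok) S
extends-disconnected {n} {Q} {S} {a} {b} {ok} disc ab (h , H) = _ , height-addArc {Q = Q} {S} {ok = ok} H′ (turn ab (sym shift-a))
  where
  in-component? : ∀ u → Dec (Star (Adjacent Q) u b)
  in-component? u = star? (adjacent? Q) u b
  -- Raising the component of `b` by `h a` and all else by `h b` equalises the heights of `a` and
  -- `b` without subtraction. When `S b a` holds, one more is added outside the component, because
  -- the new arc must then be reversed.
  lag : S a b ⊎ S b a → ℕ
  lag (inj₁ _) = h b
  lag (inj₂ _) = suc (h b)
  shift : Fin n → ℕ
  shift u = if does (in-component? u) then h a else lag ab
  shift-arc : ∀ {i j} → i ⟶[ Q ] j → shift i ≡ shift j
  shift-arc {i} {j} r with in-component? i | in-component? j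
  ... | yes _ | yes _ = refl
  ... | yes p | no ¬q = contradiction (inj₂ r ◅ p) ¬q
  ... | no ¬p | yes q = contradiction (inj₁ r ◅ q) ¬p
  ... | no _  | no _  = refl
  shift-a : shift a ≡ lag ab
  shift-a rewrite dec-false (in-component? a) (disc ∘ star⇒connected {Q = Q}) = refl
  shift-b : shift b ≡ h a
  shift-b rewrite dec-true (in-component? b) ε = refl
  H′ : Height Q S (λ u → h u + shift u)
  H′ r = Sum.map (map₂ (λ e → cong₂ _+_ e (shift-arc r))) (map₂ (λ e → cong₂ _+_ e (shift-arc r))) (H r)
  turn : (ab′ : S a b ⊎ S b a) → lag ab′ ≡ shift a → Turns S (λ u → h u + shift u) a b
  turn (inj₁ s) e = inj₁ (s , trans (cong (h a +_) (sym e)) (trans (ℕₚ.+-comm (h a) (h b)) (cong (h b +_) (sym shift-b))))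
  turn (inj₂ s) e = inj₂ (s , trans (cong (h a +_) (sym e)) (trans (ℕₚ.+-comm (h a) (suc (h b)))
                                (cong (λ x → suc (h b + x)) (sym shift-b))))

-- Heights at two vertices with a common in-neighbour

module _ {S : Rel (Fin n) 0ℓ} (asym : Asymmetric S) where

  -- If the two arcs from `v` are both kept or both reversed, `a` and `b` have equal height, which
  -- suits an arc from `a` to `b`. If only the arc to `a` is reversed, `b` is one higher, which
  -- suits a reversed arc from `b` to `a`. Reversing only the arc to `b` would place `b` before `v`
  -- before `a`.
  turns-choose : Transitive S → ∀ {h v a b} → S a b → Turns S h v a → Turns S h v b → Turns S h a b ⊎ Turns S h b a
  turns-choose tr ab (inj₁ (_ , e))  (inj₁ (_ , f))  = inj₁ (inj₁ (ab , trans (sym e) f))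
  turns-choose tr ab (inj₁ (va , _)) (inj₂ (bv , _)) = contradiction (tr bv va) (asym ab)
  turns-choose tr ab (inj₂ (_ , e))  (inj₁ (_ , f))  = inj₂ (inj₂ (ab , trans (sym f) e))
  turns-choose tr ab (inj₂ (_ , e))  (inj₂ (_ , f))  = inj₁ (inj₁ (ab , ℕₚ.suc-injective (trans (sym e) f)))

  -- Whether an arc is reversed depends on `S` alone, so any two heights differ by the same amount
  -- across it. The equality of differences is written with sums to stay in ℕ.
  turns-difference : ∀ {g h v a} → Turns S g v a → Turns S h v a → g v + h a ≡ h v + g a
  turns-difference {g} {h} {v} {a} (inj₁ (_ , e)) (inj₁ (_ , f)) =
    trans (cong₂ _+_ e (sym f)) (ℕₚ.+-comm (g a) (h v))
  turns-difference {g} {h} {v} {a} (inj₂ (_ , e)) (inj₂ (_ , f)) =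
    trans (cong (_+ h a) e) (trans (cong suc (ℕₚ.+-comm (g a) (h a))) (cong (_+ g a) (sym f)))
  turns-difference (inj₁ (s , _)) (inj₂ (t , _)) = contradiction s (asym t)
  turns-difference (inj₂ (s , _)) (inj₁ (t , _)) = contradiction s (asym t)

  -- By `turns-difference` at `a` and at `b`, both heights have the same difference between `a` and
  -- `b`. The two opposite arcs demand differences that disagree by one, whichever way `S` orders
  -- `a` and `b`.
  turns-exclude : ∀ {g h v a b} → Turns S g v a → Turns S h v a → Turns S g v b → Turns S h v b →
                  Turns S g a b → ¬ Turns S h b a
  turns-exclude {g} {h} {v} {a} {b} ga ha gb hb = exclude
    where
    da = turns-difference {g} {h} ga ha
    db = turns-difference {g} {h} gb hb
    exclude : Turns S g a b → ¬ Turns S h b a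
    exclude (inj₁ (s , _)) (inj₁ (t , _)) = asym s t
    exclude (inj₂ (s , _)) (inj₂ (t , _)) = asym s t
    exclude (inj₁ (_ , e)) (inj₂ (_ , f)) = ℕₚ.1+n≢n
      (trans (sym (ℕₚ.+-suc (g v) (h a))) (trans (cong (g v +_) (sym f)) (trans db (trans (cong (h v +_) (sym e)) (sym da)))))
    exclude (inj₂ (_ , e)) (inj₁ (_ , f)) = ℕₚ.1+n≢n
      (trans (sym (ℕₚ.+-suc (h v) (g b))) (trans (cong (h v +_) (sym e)) (trans (sym da) (trans (cong (g v +_) (sym f)) db))))

  extends-split : Transitive S → ∀ {Q : Quiver n} {v a b} {ok : Addable Q a b} {ok′ : Addable Q b a} → S a b ⊎ S b a →
                  v ⟶[ Q ] a → v ⟶[ Q ] b →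
                  Extends Q S → Extends (addArc Q a b ok) S ⊎ Extends (addArc Q b a ok′) S
  extends-split tr {Q} {ok = ok} {ok′} ab va vb (h , H) =
    Sum.map (λ t → h , height-addArc {Q = Q} {S} {ok = ok} H t) (λ t → h , height-addArc {Q = Q} {S} {ok = ok′} H t)
      ([ (λ s → turns-choose tr s (H va) (H vb)) , (λ s → Sum.swap (turns-choose tr s (H vb) (H va))) ]′ ab)

  extends-disjoint : ∀ {Q : Quiver n} {v a b} {ok : Addable Q a b} {ok′ : Addable Q b a} → v ⟶[ Q ] a → v ⟶[ Q ] b →
                     Extends (addArc Q a b ok) S → ¬ Extends (addArc Q b a ok′) S
  extends-disjoint {Q} {ok = ok} {ok′} va vb (g , G) (h , H) =
    let G′ , s = addArc-height {Q = Q} {S} {ok = ok} G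
        H′ , t = addArc-height {Q = Q} {S} {ok = ok′} H
    in turns-exclude {g} {h} (G′ va) (H′ va) (G′ vb) (H′ vb) s t

stepA-addable : ∀ {R : Quiver n} {a b} → ConditionA R a b → Addable R a b
stepA-addable {R = R} (_ , disc) = addable {Q = R}
  (λ { refl → disc (0 , []) }) (λ r → disc (1 , r ∷ []))
  (λ p → disc (star⇒connected {Q = R} (Star.reverse Sum.swap (Star.map inj₁ (plus⇒star p)))))

module _ {R : Quiver n} {a b v} (cond : ConditionB R a b v) where

  private
    inc : Incomparable R a b
    inc = proj₁ cond
    inc′ : Incomparable R b a
    inc′ = inc ∘ comparable-sym {Q = R}

  module _ {P : Quiver n} (e : closure R ∼ P) (src : IsSource P v) where

    stepB-arcs : v ⟶[ P ] a × v ⟶[ P ] b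
    stepB-arcs = arc-to (proj₁ (proj₂ (proj₂ cond))) , arc-to (proj₂ (proj₂ (proj₂ cond)))
      where
      arc-to : ∀ {x} → Adjacent (closure R) x v → v ⟶[ P ] x
      arc-to adj = [ (λ r → contradiction r (src _)) , id ]′ (∼⇒adjacent {Q = closure R} {P} e adj)

    private
      va = proj₁ stepB-arcs
      vb = proj₂ stepB-arcs
      no-path : ∀ {i j} → Incomparable R i j → ¬ PathArc P i j
      no-path = incomparable⇒¬pathArc {P = P} {R} (∼-sym (closure R) P e)

    stepB-addable : Addable P a b
    stepB-addable = addable {Q = P} (incomparable⇒≢ {Q = R} inc)
      [ no-path inc ∘ arc⇒pathArc {Q = P} , no-path inc′ ∘ arc⇒pathArc {Q = P} ]′
      -- A path from `b` to `a`, preceded by the arc from `v` to `b` and closed by the arc from `v`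
      -- to `a`, would be a toric directed path through the incomparable pair.
      (λ b≺a → no-path inc′ (bypassed⇒pathArc P (b≺a , _ , _ , vb ◅ ε , ε , va)))

    stepB-addable′ : Addable P b a
    stepB-addable′ = addable {Q = P} (incomparable⇒≢ {Q = R} inc′)
      [ no-path inc′ ∘ arc⇒pathArc {Q = P} , no-path inc ∘ arc⇒pathArc {Q = P} ]′
      (λ a≺b → no-path inc (bypassed⇒pathArc P (a≺b , _ , _ , va ◅ ε , ε , vb)))

-- Existence of an applicable step

complete-or-gap : ∀ (Q : Quiver n) → Complete Q ⊎ (∃[ i ] ∃[ j ] i ≢ j × ¬ Adjacent Q i j)
complete-or-gap Q with any? (λ i → any? λ j → ¬? (i ≟ j) ×-dec ¬? (adjacent? Q i j))
... | yes gap = inj₂ gap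
... | no ¬gap = inj₁ λ i j i≢j → decidable-stable (adjacent? Q i j) λ ¬adj → ¬gap (i , j , i≢j , ¬adj)

-- If (B) never applies, then the components of the closure are cliques, so
-- incomparable elements lie in different components.
step-applies : ∀ (R : Quiver n) → ¬ IsToricTotalOrder R →
               (∃[ a ] ∃[ b ] ConditionA R a b) ⊎ (∃[ a ] ∃[ b ] ∃[ v ] ConditionB R a b v)
step-applies {n} R ¬total with complete-or-gap (closure R)
... | inj₁ total                   = contradiction total ¬total
... | inj₂ (i₀ , j₀ , i₀≢j₀ , gap) with any? (λ a → any? λ b → any? λ v →
  ¬? (a ≟ b) ×-dec ¬? (adjacent? (closure R) a b) ×-dec adjacent? (closure R) a v ×-dec adjacent? (closure R) b v)
...   | yes (a , b , v , a≢b , ¬adj , av , bv) =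
  inj₂ (a , b , v , ¬adj ∘ comparable⇒adjacent {Q = R} a≢b , (av ∷ Sum.swap bv ∷ [] , shorter) , av , bv)
  where
  shorter : ∀ d → d ℕ.< 2 → ¬ Walk (closure R) d a b
  shorter .0 _ []        = a≢b refl
  shorter .1 _ (r ∷ [])  = ¬adj r
  shorter .(suc (suc _)) (s≤s (s≤s ())) (_ ∷ _ ∷ _)
...   | no ¬B = inj₁ (i₀ , j₀ , gap ∘ comparable⇒adjacent {Q = R} i₀≢j₀ , λ (_ , w) → [ i₀≢j₀ , gap ]′ (clique w))
  where
  old-adjacent : ∀ {i j} → Adjacent R i j → Adjacent (closure R) i j
  old-adjacent = Sum.map (λ r → closure⁺ {Q = R} (inj₁ r)) (λ r → closure⁺ {Q = R} (inj₁ r))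
  clique : ∀ {d i j} → Walk R d i j → i ≡ j ⊎ Adjacent (closure R) i j
  clique [] = inj₁ refl
  clique {i = i} {j} (_∷_ {j = m} r w) with i ≟ j | clique w
  ... | yes i≡j | _         = inj₁ i≡j
  ... | no _    | inj₁ refl = inj₂ (old-adjacent r)
  -- Were `i` and `j` not adjacent in the closure, their common neighbour `m` would make (B)
  -- applicable.
  ... | no i≢j  | inj₂ s    = inj₂ (decidable-stable (adjacent? (closure R) i j) λ ¬t →
                                ¬B (i , j , m , i≢j , ¬t , old-adjacent r , Sum.swap s))

-- Termination

-- The termination measure. Coding pairs in `Fin (n * n)` makes the set of comparable pairs a
-- `Subset`, on which strict growth is well-founded.
comparabilities : Quiver n → Subset (n ℕ.* n)
comparabilities {n} Q = Vec.tabulate λ k → does (uncurry (adjacent? (closure Q)) (remQuot n k))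

comparabilities-⊃ : ∀ {P Q : Quiver n} {a b} → (∀ {i j} → Adjacent (closure P) i j → Adjacent (closure Q) i j) →
                    Adjacent (closure Q) a b → ¬ Adjacent (closure P) a b → comparabilities Q ⊃ₛ comparabilities P
comparabilities-⊃ {n} {P} {Q} {a} {b} mono gained fresh =
  (λ {k} k∈ → ∈⁺ Q k (mono (∈⁻ P k k∈))) , combine a b
    , ∈⁺ Q (combine a b) (subst (uncurry (Adjacent (closure Q))) (sym (remQuot-combine {n} {n} a b)) gained)
    , λ ∈P → fresh (subst (uncurry (Adjacent (closure P))) (remQuot-combine {n} {n} a b) (∈⁻ P (combine a b) ∈P))
  where
  ∈⁺ : ∀ Q k → uncurry (Adjacent (closure Q)) (remQuot n k) → k ∈ₛ comparabilities Q
  ∈⁺ Q k adj = lookup⇒[]= k _ (trans (lookup∘tabulate _ k) (dec-true (uncurry (adjacent? (closure Q)) (remQuot n k)) adj))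
  ∈⁻ : ∀ Q k → k ∈ₛ comparabilities Q → uncurry (Adjacent (closure Q)) (remQuot n k)
  ∈⁻ Q k k∈ = does-true (uncurry (adjacent? (closure Q)) (remQuot n k)) (trans (sym (lookup∘tabulate _ k)) ([]=⇒lookup k∈))

⊆⇒closure-adjacent : ∀ {P Q : Quiver n} → (∀ {i j} → i ⟶[ P ] j → i ⟶[ Q ] j) →
                     ∀ {i j} → Adjacent (closure P) i j → Adjacent (closure Q) i j
⊆⇒closure-adjacent {P = P} {Q} sub = Sum.map lift lift
  where
  lift : ∀ {i j} → i ⟶[ closure P ] j → i ⟶[ closure Q ] j
  lift r with pathArc⇒bypassed P (closure⇒pathArc {Q = P} r)
  ... | i≺j , y , z , p , q , c =
    pathArc⇒closure {Q = Q} (bypassed⇒pathArc Q (mapPath sub i≺j , y , z , Star.map sub p , Star.map sub q , sub c))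

addArc-closure : ∀ {Q : Quiver n} {a b} {ok : Addable Q a b} →
                 (∀ {i j} → Adjacent Q i j → Adjacent (closure (addArc Q a b ok)) i j) × Adjacent (closure (addArc Q a b ok)) a b
addArc-closure {Q = Q} {a} {b} {ok} =
  Sum.map (λ r → keep (old r)) (λ r → keep (old r)) , inj₁ (keep new)
  where
  keep : ∀ {i j} → ExtendedArc Q a b i j → i ⟶[ closure (addArc Q a b ok) ] j
  keep x = closure⁺ {Q = addArc Q a b ok} (inj₁ (addArc⁺ {Q = Q} {ok = ok} x))

incomparable⇒¬adjacent : ∀ {Q : Quiver n} {i j} → Incomparable Q i j → ¬ Adjacent (closure Q) i j
incomparable⇒¬adjacent {Q = Q} inc = inc ∘ adjacent⇒comparable {Q = Q}

stepA-progress : ∀ {R : Quiver n} {a b} → Incomparable R a b → (ok : Addable R a b) →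
                 comparabilities (addArc R a b ok) ⊃ₛ comparabilities R
stepA-progress {R = R} {a} {b} inc ok = comparabilities-⊃ {P = R} {addArc R a b ok}
  (⊆⇒closure-adjacent {P = R} {addArc R a b ok} (λ r → addArc⁺ {Q = R} {ok = ok} (old r)))
  (proj₂ (addArc-closure {Q = R} {ok = ok})) (incomparable⇒¬adjacent {Q = R} inc)

stepB-progress : ∀ {R P : Quiver n} {a b} → closure R ∼ P → Incomparable R a b → (ok : Addable P a b) →
                 comparabilities (addArc P a b ok) ⊃ₛ comparabilities R
stepB-progress {R = R} {P} {a} {b} e inc ok = comparabilities-⊃ {P = R} {addArc P a b ok}
  (λ adj → proj₁ (addArc-closure {Q = P} {ok = ok}) (∼⇒adjacent {Q = closure R} {P} e adj))
  (proj₂ (addArc-closure {Q = P} {ok = ok})) (incomparable⇒¬adjacent {Q = R} inc)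

Terminates : List (Quiver n) → Set
Terminates = Acc (λ s′ s → s ⟹ s′)

⟹-++⁻ : ∀ (s t : List (Quiver n)) {u} → s ++ t ⟹ u →
         (∃[ s′ ] (s ⟹ s′) × u ≡ s′ ++ t) ⊎ (∃[ t′ ] (t ⟹ t′) × u ≡ s ++ t′)
⟹-++⁻ []      t st = inj₂ (_ , st , refl)
⟹-++⁻ (R ∷ s) t (here {Rs = Rs} st) = inj₁ (_ , here st , sym (++-assoc Rs s t))
⟹-++⁻ (R ∷ s) t (there st) with ⟹-++⁻ s t st
... | inj₁ (s′ , st′ , refl) = inj₁ (_ , there st′ , refl)
... | inj₂ (t′ , st′ , refl) = inj₂ (_ , st′ , refl)

-- A step replaces one list element and thus acts within one of the two parts, so each step descends
-- in one of the two accessibility proofs and leaves the other as it is.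
terminates-++ : ∀ {s t : List (Quiver n)} → Terminates s → Terminates t → Terminates (s ++ t)
terminates-++ {s = s} {t} (acc f) (acc g) = acc λ st → next (⟹-++⁻ s t st)
  where
  next : ∀ {u} → (∃[ s′ ] (s ⟹ s′) × u ≡ s′ ++ t) ⊎ (∃[ t′ ] (t ⟹ t′) × u ≡ s ++ t′) → Terminates u
  next (inj₁ (s′ , st , refl)) = terminates-++ (f st) (acc g)
  next (inj₂ (t′ , st , refl)) = terminates-++ (acc f) (g st)

terminates : ∀ (Q : Quiver n) → Terminates (Q ∷ [])
terminates Q = go Q (⊃-wellFounded _)
  where
  go : ∀ Q → Acc _⊃ₛ_ (comparabilities Q) → Terminates (Q ∷ [])
  go Q (acc rec) = acc next
    where
    next : ∀ {s} → Q ∷ [] ⟹ s → Terminates s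
    next (here (stepA _ (inc , _) ok)) = go _ (rec (stepA-progress {R = Q} inc ok))
    next (here (stepB {R′ = P} _ (inc , _) e _ ok ok′)) =
      terminates-++ {s = _ ∷ []} (go _ (rec (stepB-progress {R = Q} {P} e inc ok)))
                                 (go _ (rec (stepB-progress {R = Q} {P} e (inc ∘ comparable-sym {Q = Q}) ok′)))
    next (there ())

-- Reals modulo 1

fromℤ : ℤ → ℚ
fromℤ k = k ℚ./ 1

fromℤ-+ : ∀ k m → fromℤ (k ℤ.+ m) ≡ fromℤ k ℚ.+ fromℤ m
fromℤ-+ k m = ℚₚ.toℚᵘ-injective (begin
  ℚ.toℚᵘ (fromℤ (k ℤ.+ m))                  ≈⟨ ℚₚ.toℚᵘ-fromℚᵘ (mkℚᵘ (k ℤ.+ m) 0) ⟩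
  mkℚᵘ (k ℤ.+ m) 0                          ≈⟨ *≡* (cong (ℤ._* ℤ.+ 1) (cong₂ ℤ._+_ (sym (ℤₚ.*-identityʳ k)) (sym (ℤₚ.*-identityʳ m)))) ⟩
  mkℚᵘ k 0 ℚᵘ.+ mkℚᵘ m 0                    ≈⟨ ℚᵘₚ.+-cong (ℚₚ.toℚᵘ-fromℚᵘ (mkℚᵘ k 0)) (ℚₚ.toℚᵘ-fromℚᵘ (mkℚᵘ m 0)) ⟨
  ℚ.toℚᵘ (fromℤ k) ℚᵘ.+ ℚ.toℚᵘ (fromℤ m)    ≈⟨ ℚₚ.toℚᵘ-homo-+ (fromℤ k) (fromℤ m) ⟨
  ℚ.toℚᵘ (fromℤ k ℚ.+ fromℤ m)              ∎)
  where open import Relation.Binary.Reasoning.Setoid ℚᵘₚ.≃-setoid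

fromℤ-mono-≤ : ∀ {k m} → k ℤ.≤ m → fromℤ k ℚ.≤ fromℤ m
fromℤ-mono-≤ {k} {m} k≤m = ℚₚ.toℚᵘ-cancel-≤ (begin
  ℚ.toℚᵘ (fromℤ k)    ≃⟨ ℚₚ.toℚᵘ-fromℚᵘ (mkℚᵘ k 0) ⟩
  mkℚᵘ k 0            ≤⟨ *≤* (ℤₚ.*-monoʳ-≤-nonNeg (ℤ.+ 1) k≤m) ⟩
  mkℚᵘ m 0            ≃⟨ ℚₚ.toℚᵘ-fromℚᵘ (mkℚᵘ m 0) ⟨
  ℚ.toℚᵘ (fromℤ m)    ∎)
  where open ℚᵘₚ.≤-Reasoning

minus-assoc : ∀ q c d → q ℚ.- (c ℚ.+ d) ≡ (q ℚ.- c) ℚ.- d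
minus-assoc q c d = trans (cong (q ℚ.+_) (ℚₚ.neg-distrib-+ c d)) (sym (ℚₚ.+-assoc q (ℚ.- c) (ℚ.- d)))

upper-closed-≤ : ∀ x {p q} → p ℚ.≤ q → Upper x p → Upper x q
upper-closed-≤ x {p} {q} p≤q u with ℚₚ.<-cmp p q
... | tri< p<q _ _  = ℝ.upper-closed x p<q u
... | tri≈ _ refl _ = u
... | tri> _ _ q<p  = contradiction (ℚₚ.<-≤-trans q<p p≤q) (ℚₚ.<-irrefl refl)

<ᵣ⇒≱ᵣ : ∀ {x y} → x <ᵣ y → ¬ y ≤ᵣ x
<ᵣ⇒≱ᵣ {x} (q , u , l) y≤x = ℝ.disjoint x (y≤x l) u

<ᵣ-asym : ∀ {x y} → x <ᵣ y → ¬ y <ᵣ x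
<ᵣ-asym {x} {y} (q , ux , ly) (p , uy , lx) with ℚₚ.<-cmp q p
... | tri< q<p _ _  = ℝ.disjoint x (ℝ.lower-closed x q<p lx) ux
... | tri≈ _ refl _ = ℝ.disjoint x lx ux
... | tri> _ _ p<q  = ℝ.disjoint y (ℝ.lower-closed y p<q ly) uy

≤ᵣ-upper : ∀ {x y} → x ≤ᵣ y → Upper y ⊆ Upper x
≤ᵣ-upper {x} {y} x≤y u with ℝ.upper-open y u
... | p , p<q , v with ℝ.located x p<q
...   | inj₁ l = contradiction v (ℝ.disjoint y (x≤y l))
...   | inj₂ w = w

+ᶻ-mono-≤ : ∀ x y {k l} m → x +ᶻ k ≤ᵣ y +ᶻ l → x +ᶻ (m ℤ.+ k) ≤ᵣ y +ᶻ (m ℤ.+ l)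
+ᶻ-mono-≤ x y {k} {l} m le {q} lx =
  subst (Lower y) (sym (eq l)) (le {q ℚ.- fromℤ m} (subst (Lower x) (eq k) lx))
  where
  eq : ∀ k → q ℚ.- fromℤ (m ℤ.+ k) ≡ (q ℚ.- fromℤ m) ℚ.- fromℤ k
  eq k = trans (cong (λ c → q ℚ.- c) (fromℤ-+ m k)) (minus-assoc q (fromℤ m) (fromℤ k))

unit-resp-≈ : ∀ {x y} → x ≈ᵣ y → InUnitInterval x → InUnitInterval y
unit-resp-≈ {x} {y} (x≤y , y≤x) (0≤x , q , u , q<1) =
  (λ {p} l → x≤y (0≤x {p} l)) , q , ≤ᵣ-upper {y} {x} y≤x u , q<1

unit-≮ : ∀ x {k l} → k ℤ.< l → InUnitInterval (x +ᶻ k) → ¬ InUnitInterval (x +ᶻ l)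
unit-≮ x {k} {l} k<l (0≤x+k , _) (_ , q , u , q<1) =
  -- `q` is an upper bound of `x +ᶻ l` below 1. Being negative, q - 1 is a lower bound of `x +ᶻ k`;
  -- but `k < l` makes it an upper bound of `x +ᶻ k` too.
  ℝ.disjoint x (0≤x+k {q ℚ.- 1ℚ} q-1<0) (upper-closed-≤ x le u)
  where
  q-1<0 : q ℚ.- 1ℚ ℚ.< 0ℚ
  q-1<0 = ℚₚ.+-monoˡ-< (ℚ.- 1ℚ) q<1
  le : q ℚ.- fromℤ l ℚ.≤ (q ℚ.- 1ℚ) ℚ.- fromℤ k
  le = subst (q ℚ.- fromℤ l ℚ.≤_) (minus-assoc q 1ℚ (fromℤ k))
         (ℚₚ.+-monoʳ-≤ q (ℚₚ.neg-antimono-≤ 1+k≤l))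
    where
    1+k≤l : 1ℚ ℚ.+ fromℤ k ℚ.≤ fromℤ l
    1+k≤l = subst (ℚ._≤ fromℤ l) (fromℤ-+ (ℤ.+ 1) k) (fromℤ-mono-≤ (ℤₚ.i<j⇒suc[i]≤j k<l))

unit-unique : ∀ x k l → InUnitInterval (x +ᶻ k) → InUnitInterval (x +ᶻ l) → k ≡ l
unit-unique x k l uk ul with ℤₚ.<-cmp k l
... | tri< k<l _ _ = contradiction ul (unit-≮ x k<l uk)
... | tri≈ _ e _   = e
... | tri> _ _ l<k = contradiction uk (unit-≮ x l<k ul)

<mod1-asym : ∀ {x y} → x <mod1 y → ¬ y <mod1 x
<mod1-asym {x} {y} (k , l , ux , uy , lt) (l′ , k′ , uy′ , ux′ , gt)
  with unit-unique x k k′ ux ux′ | unit-unique y l l′ uy uy′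
... | refl | refl = <ᵣ-asym {x +ᶻ k} {y +ᶻ l} lt gt

-- If two translates agreed, shifting both by `m` would bring that of `y` to its representative in
-- [0,1). The equal translate of `x` then lies in [0,1) as well and is the representative of `x`, so
-- the representatives would be equal and not strictly ordered.
<mod1⇒≉ : ∀ {x y} → x <mod1 y → ∀ {k l} → ¬ x +ᶻ k ≈ᵣ y +ᶻ l
<mod1⇒≉ {x} {y} (k₀ , l₀ , ux , uy , lt) {k} {l} (le , ge) =
  <ᵣ⇒≱ᵣ {x +ᶻ k₀} {y +ᶻ l₀} lt λ {q} → subst (λ z → Lower (x +ᶻ z) q) k≡k₀ ∘ l₀≤ {q}
  where
  m = l₀ ℤ.- l
  l₀≡ : m ℤ.+ l ≡ l₀
  l₀≡ = trans (ℤₚ.+-assoc l₀ (ℤ.- l) l) (trans (cong (λ z → l₀ ℤ.+ z) (ℤₚ.+-inverseˡ l)) (ℤₚ.+-identityʳ l₀))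
  ≤l₀ : x +ᶻ (m ℤ.+ k) ≤ᵣ y +ᶻ l₀
  ≤l₀ {q} = subst (λ z → Lower (y +ᶻ z) q) l₀≡ ∘ +ᶻ-mono-≤ x y {k} {l} m (λ {p} → le {p}) {q}
  l₀≤ : y +ᶻ l₀ ≤ᵣ x +ᶻ (m ℤ.+ k)
  l₀≤ {q} = +ᶻ-mono-≤ y x {l} {k} m (λ {p} → ge {p}) {q} ∘ subst (λ z → Lower (y +ᶻ z) q) (sym l₀≡)
  k≡k₀ : m ℤ.+ k ≡ k₀
  k≡k₀ = unit-unique x (m ℤ.+ k) k₀
    (unit-resp-≈ {y +ᶻ l₀} {x +ᶻ (m ℤ.+ k)} ((λ {q} → l₀≤ {q}) , λ {q} → ≤l₀ {q}) uy) ux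

-- A strictly increasing sequence in [0,1), each term chosen by density between the previous one and
-- 1. It supplies the coordinates of `samplePoint`.
unitSequence : ℕ → ∃[ q ] 0ℚ ℚ.≤ q × q ℚ.< 1ℚ
unitSequence zero    = 0ℚ , ℚₚ.≤-refl , toWitness {a? = 0ℚ ℚₚ.<? 1ℚ} _
unitSequence (suc m) with unitSequence m
... | q , 0≤q , q<1 = let r , q<r , r<1 = ℚₚ.<-dense q<1 in r , ℚₚ.<⇒≤ (ℚₚ.≤-<-trans 0≤q q<r) , r<1

unitValue : ℕ → ℚ
unitValue m = proj₁ (unitSequence m)

unitValue-mono-< : ∀ {k m} → k ℕ.< m → unitValue k ℚ.< unitValue m
unitValue-mono-< {k} {suc m} (s≤s k≤m) with ℕₚ.m≤n⇒m<n∨m≡n k≤m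
... | inj₁ k<m  = ℚₚ.<-trans (unitValue-mono-< k<m) (proj₁ (proj₂ (ℚₚ.<-dense (proj₂ (proj₂ (unitSequence m))))))
... | inj₂ refl = proj₁ (proj₂ (ℚₚ.<-dense (proj₂ (proj₂ (unitSequence m)))))

fromℚ-unit : ∀ {q} → 0ℚ ℚ.≤ q → q ℚ.< 1ℚ → InUnitInterval (fromℚ q +ᶻ ℤ.+ 0)
fromℚ-unit {q} 0≤q q<1 =
  (λ {p} p<0 → subst (ℚ._< q) (sym (ℚₚ.+-identityʳ p)) (ℚₚ.<-≤-trans p<0 0≤q)) ,
  let r , q<r , r<1 = ℚₚ.<-dense q<1 in r , subst (q ℚ.<_) (sym (ℚₚ.+-identityʳ r)) q<r , r<1

fromℚ-<mod1 : ∀ {p q} → 0ℚ ℚ.≤ p → p ℚ.< q → q ℚ.< 1ℚ → fromℚ p <mod1 fromℚ q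
fromℚ-<mod1 {p} {q} 0≤p p<q q<1 =
  ℤ.+ 0 , ℤ.+ 0 , fromℚ-unit 0≤p (ℚₚ.<-trans p<q q<1) , fromℚ-unit (ℚₚ.≤-trans 0≤p (ℚₚ.<⇒≤ p<q)) q<1 ,
  let r , p<r , r<q = ℚₚ.<-dense p<q
  in r , subst (p ℚ.<_) (sym (ℚₚ.+-identityʳ r)) p<r , subst (ℚ._< q) (sym (ℚₚ.+-identityʳ r)) r<q

-- Toric total extensions

Before : Permutation′ n → Rel (Fin n) 0ℓ
Before w i j = w ⟨$⟩ˡ i Fin.< w ⟨$⟩ˡ j

module _ (w : Permutation′ n) where

  before-trans : Transitive (Before w)
  before-trans = ℕₚ.<-trans

  before-asym : Asymmetric (Before w)
  before-asym = ℕₚ.<-asym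

  before-total : ∀ {i j} → i ≢ j → Before w i j ⊎ Before w j i
  before-total {i} {j} i≢j with Finₚ.<-cmp (w ⟨$⟩ˡ i) (w ⟨$⟩ˡ j)
  ... | tri< lt _ _ = inj₁ lt
  ... | tri> _ _ gt = inj₂ gt
  ... | tri≈ _ e _  = contradiction (trans (sym (inverseʳ w)) (trans (cong (w ⟨$⟩ʳ_) e) (inverseʳ w))) i≢j

  totalQuiver⁻ : ∀ {i j} → i ⟶[ totalQuiver w ] j → Before w i j
  totalQuiver⁻ = toWitness

  totalQuiver⁺ : ∀ {i j} → Before w i j → i ⟶[ totalQuiver w ] j
  totalQuiver⁺ = fromWitness

-- Order of entries in listings and their rotations

precedes-tabulate⁺ : ∀ {A : Set} {f : Fin n → A} {p q} → p Fin.< q → Precedes (f p) (f q) (tabulate f)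
precedes-tabulate⁺ {p = zero}  {suc q} _         = here (∈-tabulate⁺ q)
precedes-tabulate⁺ {p = suc p} {suc q} (s≤s p<q) = there (precedes-tabulate⁺ p<q)

precedes-tabulate⁻ : ∀ {A : Set} {f : Fin n → A} {i j} → Precedes i j (tabulate f) →
                     ∃[ p ] ∃[ q ] p Fin.< q × i ≡ f p × j ≡ f q
precedes-tabulate⁻ {suc n} (here j∈)   = let q , e = ∈-tabulate⁻ j∈ in zero , suc q , s≤s z≤n , refl , e
precedes-tabulate⁻ {suc n} (there pre) = let p , q , p<q , e = precedes-tabulate⁻ pre in suc p , suc q , s≤s p<q , e

before⇒precedes : ∀ (w : Permutation′ n) {i j} → Before w i j → Precedes i j (listing w)
before⇒precedes w {i} {j} lt = subst₂ (λ a b → Precedes a b (listing w)) (inverseʳ w) (inverseʳ w) (precedes-tabulate⁺ lt)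

precedes⇒before : ∀ (w : Permutation′ n) {i j} → Precedes i j (listing w) → Before w i j
precedes⇒before w pre with precedes-tabulate⁻ pre
... | p , q , p<q , refl , refl = subst₂ Fin._<_ (sym (inverseˡ w)) (sym (inverseˡ w)) p<q

module _ {A : Set} {i j : A} where

  precedes-++⁻ : ∀ us {vs} → Precedes i j (us ++ vs) → Precedes i j us ⊎ (i ∈ us × j ∈ vs) ⊎ Precedes i j vs
  precedes-++⁻ []       pre         = inj₂ (inj₂ pre)
  precedes-++⁻ (u ∷ us) (here j∈)   = Sum.map here (λ j∈ → inj₁ (here refl , j∈)) (∈-++⁻ us j∈)
  precedes-++⁻ (u ∷ us) (there pre) = Sum.map there (Sum.map₁ (λ (i∈ , j∈) → there i∈ , j∈)) (precedes-++⁻ us pre)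

  precedes-++⁺ˡ : ∀ {us} vs → Precedes i j us → Precedes i j (us ++ vs)
  precedes-++⁺ˡ vs (here j∈)   = here (∈-++⁺ˡ j∈)
  precedes-++⁺ˡ vs (there pre) = there (precedes-++⁺ˡ vs pre)

  precedes-++⁺ʳ : ∀ us {vs} → Precedes i j vs → Precedes i j (us ++ vs)
  precedes-++⁺ʳ []       pre = pre
  precedes-++⁺ʳ (u ∷ us) pre = there (precedes-++⁺ʳ us pre)

  precedes-++⁺ : ∀ {us vs} → i ∈ us → j ∈ vs → Precedes i j (us ++ vs)
  precedes-++⁺ {u ∷ us} (here refl) j∈ = here (∈-++⁺ʳ us j∈)
  precedes-++⁺          (there i∈)  j∈ = there (precedes-++⁺ i∈ j∈)

-- Moving the initial segment us to the end flips each of its elements once.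
rotation-extends : ∀ (w w′ : Permutation′ n) → w ≈rot w′ → Extends (totalQuiver w) (Before w′)
rotation-extends {n} w w′ (us , vs , e , e′) =
  h , λ {i} {j} r → turn (precedes-++⁻ us (subst (Precedes i j) e (before⇒precedes w (totalQuiver⁻ w r))))
  where
  h : Fin n → ℕ
  h i = indicator (DecMembership._∈?_ _≟_ i us)
  in-us : ∀ {i} → i ∈ us → h i ≡ 1
  in-us {i} = indicator-yes (DecMembership._∈?_ _≟_ i us)
  in-vs : ∀ {i} → i ∈ vs → h i ≡ 0
  in-vs {i} i∈vs = indicator-no (DecMembership._∈?_ _≟_ i us) λ i∈us →
    ℕₚ.<-irrefl refl (precedes⇒before w (subst (Precedes i i) (sym e) (precedes-++⁺ i∈us i∈vs)))
  after : ∀ {i j} → Precedes i j (vs ++ us) → Before w′ i j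
  after {i} {j} pre = precedes⇒before w′ (subst (Precedes i j) (sym e′) pre)
  turn : ∀ {i j} → Precedes i j us ⊎ (i ∈ us × j ∈ vs) ⊎ Precedes i j vs → Turns (Before w′) h i j
  turn (inj₁ pre)              = inj₁ (after (precedes-++⁺ʳ vs pre) , trans (in-us (precedes-∈ˡ pre)) (sym (in-us (precedes-∈ʳ pre))))
  turn (inj₂ (inj₁ (i∈ , j∈))) = inj₂ (after (precedes-++⁺ j∈ i∈) , trans (in-us i∈) (cong suc (sym (in-vs j∈))))
  turn (inj₂ (inj₂ pre))       = inj₁ (after (precedes-++⁺ˡ us pre) , trans (in-vs (precedes-∈ˡ pre)) (sym (in-vs (precedes-∈ʳ pre))))

-- Points of toric chambers and the orientations they determine

Increasing : Permutation′ n → Point n → Set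
Increasing w x = ∀ {i j} → i Fin.< j → x (w ⟨$⟩ʳ i) <mod1 x (w ⟨$⟩ʳ j)

module _ (w : Permutation′ n) {x : Point n} (inc : Increasing w x) where

  before⇒<mod1 : ∀ {i j} → Before w i j → x i <mod1 x j
  before⇒<mod1 lt = subst₂ (λ i j → x i <mod1 x j) (inverseʳ w) (inverseʳ w) (inc lt)

  <mod1⇒before : ∀ {i j} → i ≢ j → x i <mod1 x j → Before w i j
  <mod1⇒before {i} {j} i≢j lt with before-total w i≢j
  ... | inj₁ b = b
  ... | inj₂ b = contradiction (before⇒<mod1 b) (<mod1-asym {x i} {x j} lt)

module _ (w : Permutation′ n) where

  samplePoint : Point n
  samplePoint i = fromℚ (unitValue (Fin.toℕ (w ⟨$⟩ˡ i)))

  samplePoint-increasing : Increasing w samplePoint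
  samplePoint-increasing {i} {j} i<j =
    subst₂ (λ p q → fromℚ (unitValue (Fin.toℕ p)) <mod1 fromℚ (unitValue (Fin.toℕ q)))
      (sym (inverseˡ w)) (sym (inverseˡ w))
      (fromℚ-<mod1 (proj₁ (proj₂ (unitSequence (Fin.toℕ i)))) (unitValue-mono-< i<j) (proj₂ (proj₂ (unitSequence (Fin.toℕ j)))))

  samplePoint-chamber : TotalChamber w samplePoint
  samplePoint-chamber = w , ([] , listing w , refl , sym (++-identityʳ _)) , samplePoint-increasing

module _ (Q : Quiver n) (w : Permutation′ n) where

  orient : Quiver n
  orient = fromRelation (λ i j → Adjacent Q i j × Before w i j)
    (λ i j → adjacent? Q i j ×-dec w ⟨$⟩ˡ i Finₚ.<? w ⟨$⟩ˡ j)
    (acyclic (totalQuiver w) ∘ mapPath (totalQuiver⁺ w ∘ proj₂))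

  orient⁺ : ∀ {i j} → Adjacent Q i j × Before w i j → i ⟶[ orient ] j
  orient⁺ = fromWitness

  orient⁻ : ∀ {i j} → i ⟶[ orient ] j → Adjacent Q i j × Before w i j
  orient⁻ = toWitness

  orient-extends : Extends Q (Before w) → Extends Q (arrow orient)
  orient-extends (h , H) = h , λ r → Sum.map (λ (s , e) → orient⁺ (inj₁ r , s) , e) (λ (s , e) → orient⁺ (inj₂ r , s) , e) (H r)

  orient-determined : ∀ {x : Point n} → Increasing w x → Determines Q x orient
  orient-determined {x} inc i j = mk⇔ (λ r → map₂ (before⇒<mod1 w {x} inc) (orient⁻ r))
    (λ (adj , lt) → orient⁺ (adj , <mod1⇒before w {x} inc (adjacent⇒≢ Q adj) lt))

  increasing⇒∉arrangement : ∀ {x : Point n} → Increasing w x → ¬ ToricArrangement Q x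
  increasing⇒∉arrangement {x} inc (y , shifts , i , j , adj , yi≤yj , yj≤yi) =
    [ (λ b → <mod1⇒≉ {x i} {x j} (before⇒<mod1 w {x} inc b) {k} {l} ((λ {q} → le {q}) , λ {q} → ge {q}))
    , (λ b → <mod1⇒≉ {x j} {x i} (before⇒<mod1 w {x} inc b) {l} {k} ((λ {q} → ge {q}) , λ {q} → le {q})) ]′
      (before-total w (adjacent⇒≢ Q adj))
    where
    k = proj₁ (shifts i)
    l = proj₁ (shifts j)
    le : x i +ᶻ k ≤ᵣ x j +ᶻ l
    le {q} = proj₁ (proj₂ (shifts j)) {q} ∘ yi≤yj {q} ∘ proj₂ (proj₂ (shifts i)) {q}
    ge : x j +ᶻ l ≤ᵣ x i +ᶻ k
    ge {q} = proj₁ (proj₂ (shifts i)) {q} ∘ yj≤yi {q} ∘ proj₂ (proj₂ (shifts j)) {q}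

  -- One point of the chamber is enough: the orientation determined by `samplePoint` agrees with
  -- `w`, so a height from `Q` to that orientation is a height to `w`.
  𝓛⇒extends : 𝓛 Q w → Extends Q (Before w)
  𝓛⇒extends L with L {samplePoint w} (samplePoint-chamber w)
  ... | _ , O , det , e = extends-mono {Q = Q} arc⇒before (∼⇒extends {Q = Q} {O} e)
    where
    arc⇒before : ∀ {i j} → i ⟶[ O ] j → Before w i j
    arc⇒before {i} {j} r = let adj , lt = Equivalence.to (det i j) r in
      <mod1⇒before w {samplePoint w} (samplePoint-increasing w) (adjacent⇒≢ Q adj) lt

-- A point of the chamber of `w` increases along some rotation `w′`. Adding the height of the
-- rotation to that of `w` over `Q` gives a height of `w′`, and hence the equivalence of `Q` with
-- the orientation determined by the point.
extends⇒𝓛 : ∀ (Q : Quiver n) w → Extends Q (Before w) → 𝓛 Q w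
extends⇒𝓛 Q w ext {x} (w′ , rot , inc) =
  increasing⇒∉arrangement Q w′ {x} inc , orient Q w′ , orient-determined Q w′ {x} inc ,
  extends⇒∼ {Q = Q} {orient Q w′} (proj₁ ∘ orient⁻ Q w′)
    (orient-extends Q w′ (extends-trans {Q = Q} {totalQuiver w} (extends-mono {Q = Q} (totalQuiver⁺ w) ext) (rotation-extends w w′ rot)))

-- Listing a complete acyclic quiver in order

-- Pigeonhole principle: a missed value could be punched out of the codomain, leaving an injection
-- into a smaller set.
surjective : ∀ (f : Fin n → Fin n) → (∀ {i j} → f i ≡ f j → i ≡ j) → ∀ y → ∃[ x ] f x ≡ y
surjective {suc n} f inj y with any? (λ x → f x ≟ y)
... | yes hit = hit
... | no miss = contradiction
  (Finₚ.injective⇒≤ {f = λ x → punchOut (avoid x)} λ {i} {j} e → inj (punchOut-injective (avoid i) (avoid j) e))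
  ℕₚ.1+n≰n
  where
  avoid : ∀ x → y ≢ f x
  avoid x e = miss (x , sym e)

permutationˡ : ∀ (f : Fin n → Fin n) → (∀ {i j} → f i ≡ f j → i ≡ j) → ∃[ w ] ∀ i → w ⟨$⟩ˡ i ≡ f i
permutationˡ {n} f inj = permutation (proj₁ ∘ onto) f (λ i → inj (proj₂ (onto (f i)))) (proj₂ ∘ onto) , λ _ → refl
  where onto = surjective f inj

module _ (Q : Quiver n) where

  private
    below : Fin n → Subset n
    below i = Vec.tabulate λ u → does (plus? (Quiver._⟶?_ Q) u i)

    below⁺ : ∀ {u i} → u ≺[ Q ] i → u ∈ₛ below i
    below⁺ {u} {i} p = lookup⇒[]= u _ (trans (lookup∘tabulate _ u) (dec-true (plus? (Quiver._⟶?_ Q) u i) p))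

    below⁻ : ∀ {u i} → u ∈ₛ below i → u ≺[ Q ] i
    below⁻ {u} {i} u∈ = does-true (plus? (Quiver._⟶?_ Q) u i) (trans (sym (lookup∘tabulate _ u)) ([]=⇒lookup u∈))

    below-< : ∀ i → ∣ below i ∣ ℕ.< n
    below-< i = subst (∣ below i ∣ ℕ.<_) (∣⊤∣≡n n)
      (p⊂q⇒∣p∣<∣q∣ {p = below i} {⊤} ((λ _ → ∈⊤) , i , ∈⊤ , acyclic Q ∘ below⁻))

    rank : Fin n → Fin n
    rank i = fromℕ< (below-< i)

    rank-mono : ∀ {i j} → i ⟶[ Q ] j → rank i Fin.< rank j
    rank-mono {i} {j} r = subst₂ ℕ._<_ (sym (Finₚ.toℕ-fromℕ< (below-< i))) (sym (Finₚ.toℕ-fromℕ< (below-< j)))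
      (p⊂q⇒∣p∣<∣q∣ {p = below i} {below j} ((λ u∈ → below⁺ (below⁻ u∈ ++⁺ [ r ])) , i , below⁺ [ r ] , acyclic Q ∘ below⁻))

  -- The position of a vertex is the number of its strict ancestors, which is below `n` since a
  -- vertex is not its own ancestor. An arc from `i` to `j` adds at least `i` to the ancestors, so
  -- positions increase along arcs; completeness then makes them distinct.
  complete⇒listing : Complete Q → ∃[ w ] ∀ {i j} → i ⟶[ Q ] j → Before w i j
  complete⇒listing complete =
    let w , e = permutationˡ rank rank-injective
    in w , λ {i} {j} r → subst₂ Fin._<_ (sym (e i)) (sym (e j)) (rank-mono r)
    where
    rank-injective : ∀ {i j} → rank i ≡ rank j → i ≡ j
    rank-injective {i} {j} e = decidable-stable (i ≟ j) λ i≢j →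
      [ (λ r → ℕₚ.<-irrefl (cong toℕ e) (rank-mono r))
      , (λ r → ℕₚ.<-irrefl (cong toℕ (sym e)) (rank-mono r)) ]′ (complete i j i≢j)

-- Correctness of the algorithm

module _ {P : Quiver n} {w : Permutation′ n} where

  corresponds⇒extends : CorrespondsTo P w → Extends P (Before w)
  corresponds⇒extends (_ , e) =
    closure-extends {Q = P} (extends-mono {Q = closure P} (totalQuiver⁻ w) (∼⇒extends {Q = closure P} {totalQuiver w} e))

  extends⇒corresponds : IsToricTotalOrder P → Extends P (Before w) → CorrespondsTo P w
  extends⇒corresponds total ext = total ,
    extends⇒∼ {Q = closure P} {totalQuiver w}
      (λ r → total _ _ (adjacent⇒≢ (totalQuiver w) (inj₁ r)))
      (extends-mono {Q = closure P} (totalQuiver⁺ w) (extends-closure {Q = P} {Before w} (before-trans w) ext))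

corresponding-order : ∀ {P : Quiver n} → IsToricTotalOrder P → ∃[ w ] CorrespondsTo P w
corresponding-order {P = P} total =
  let w , mono = complete⇒listing (closure P) total
  in w , extends⇒corresponds {P = P} {w} total
           -- The listing respects every arc of the closure, so the zero height serves.
           (closure-extends {Q = P} ((λ _ → 0) , λ r → inj₁ (mono r , refl)))

module _ (w : Permutation′ n) where

  stepA-extends : ∀ {R : Quiver n} {a b} → ConditionA R a b → (ok : Addable R a b) →
                  Extends R (Before w) → Extends (addArc R a b ok) (Before w)
  stepA-extends {R} (inc , disc) ok =
    extends-disconnected {Q = R} {Before w} {ok = ok} disc (before-total w (incomparable⇒≢ {Q = R} inc))

  module _ {R : Quiver n} {a b v} (cond : ConditionB R a b v) {P : Quiver n} (e : closure R ∼ P) (src : IsSource P v)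
           {ok : Addable P a b} {ok′ : Addable P b a} where

    private arcs = stepB-arcs {R = R} cond {P} e src

    stepB-split : Extends R (Before w) → Extends (addArc P a b ok) (Before w) ⊎ Extends (addArc P b a ok′) (Before w)
    stepB-split ext =
      extends-split (before-asym w) (before-trans w) {P} {ok = ok} {ok′} (before-total w (incomparable⇒≢ {Q = R} (proj₁ cond)))
        (proj₁ arcs) (proj₂ arcs)
        (extends-trans {Q = P} {closure R} (∼⇒extends {Q = P} {closure R} (∼-sym (closure R) P e))
          (extends-closure {Q = R} {Before w} (before-trans w) ext))

    stepB-disjoint : Extends (addArc P a b ok) (Before w) → ¬ Extends (addArc P b a ok′) (Before w)
    stepB-disjoint = extends-disjoint (before-asym w) {P} {ok = ok} {ok′} (proj₁ arcs) (proj₂ arcs)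

  stepB-extends : ∀ {R P : Quiver n} → closure R ∼ P → ∀ {a b} {ok : Addable P a b} →
                  Extends (addArc P a b ok) (Before w) → Extends R (Before w)
  stepB-extends {R} {P} e {ok = ok} ext =
    closure-extends {Q = R} (extends-trans {Q = closure R} {P} (∼⇒extends {Q = closure R} {P} e)
      (addArc-extends {Q = P} {Before w} {ok = ok} ext))

-- Invariants of a run of the algorithm

Disjoint : Rel (Quiver n) 0ℓ
Disjoint P P′ = ∀ w → Extends P (Before w) → ¬ Extends P′ (Before w)

-- The invariants are stated by extension and not by correspondence, as the latter has meaning only
-- for members that are already total.
ExtendsSome : List (Quiver n) → Permutation′ n → Set
ExtendsSome s w = Any (λ P → Extends P (Before w)) s

module _ {R : Quiver n} where

  ⇝-extends⁺ : ∀ {Rs} → R ⇝ Rs → ∀ w → Extends R (Before w) → ExtendsSome Rs w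
  ⇝-extends⁺ (stepA _ cond ok) w ext = here (stepA-extends w {R} cond ok ext)
  ⇝-extends⁺ (stepB {R′ = P} _ cond e src ok ok′) w ext =
    [ here , (λ ext′ → there (here ext′)) ]′ (stepB-split w {R} cond {P} e src {ok} {ok′} ext)

  ⇝-extends⁻ : ∀ {Rs} → R ⇝ Rs → ∀ w → ExtendsSome Rs w → Extends R (Before w)
  ⇝-extends⁻ (stepA _ _ ok) w (here ext) = addArc-extends {Q = R} {Before w} {ok = ok} ext
  ⇝-extends⁻ (stepB {R′ = P} _ _ e _ ok _)  w (here ext)         = stepB-extends w {R} {P} e {ok = ok} ext
  ⇝-extends⁻ (stepB {R′ = P} _ _ e _ _ ok′) w (there (here ext)) = stepB-extends w {R} {P} e {ok = ok′} ext

  ⇝-disjoint : ∀ {Rs} → R ⇝ Rs → AllPairs Disjoint Rs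
  ⇝-disjoint (stepA _ _ _) = [] ∷ []
  ⇝-disjoint (stepB {R′ = P} _ cond e src ok ok′) =
    ((λ w → stepB-disjoint w {R} cond {P} e src {ok} {ok′}) ∷ []) ∷ [] ∷ []

⟹-extends⁺ : ∀ {s s′ : List (Quiver n)} → s ⟹ s′ → ∀ w → ExtendsSome s w → ExtendsSome s′ w
⟹-extends⁺ (here st)           w (here ext)  = Anyₚ.++⁺ˡ (⇝-extends⁺ st w ext)
⟹-extends⁺ (here {Rs = Rs} st) w (there any) = Anyₚ.++⁺ʳ Rs any
⟹-extends⁺ (there st)          w (here ext)  = here ext
⟹-extends⁺ (there st)          w (there any) = there (⟹-extends⁺ st w any)

⟹-extends⁻ : ∀ {s s′ : List (Quiver n)} → s ⟹ s′ → ∀ w → ExtendsSome s′ w → ExtendsSome s w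
⟹-extends⁻ (here {Rs = Rs} st) w any         = [ (λ x → here (⇝-extends⁻ st w x)) , there ]′ (Anyₚ.++⁻ Rs any)
⟹-extends⁻ (there st)          w (here ext)  = here ext
⟹-extends⁻ (there st)          w (there any) = there (⟹-extends⁻ st w any)

-- An order extending one of the replacements extends the replaced quiver too, so the replacements
-- inherit its disjointness from the other members; among themselves they are disjoint by
-- `⇝-disjoint`.
⟹-disjoint : ∀ {s s′ : List (Quiver n)} → s ⟹ s′ → AllPairs Disjoint s → AllPairs Disjoint s′
⟹-disjoint (here st) (R# ∷ s#) = AllPairsₚ.++⁺ (⇝-disjoint st) s#
  (All.tabulate λ P∈ → All.map (λ R#S w ext → R#S w (⇝-extends⁻ st w (lose P∈ ext))) R#)
⟹-disjoint (there st) (R# ∷ s#) =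
  All.tabulate (λ P∈ w extR extP → let S , S∈ , extS = find (⟹-extends⁻ st w (lose P∈ extP)) in All.lookup R# S∈ w extR extS)
    ∷ ⟹-disjoint st s#

run-extends⁺ : ∀ {s s′ : List (Quiver n)} → Star _⟹_ s s′ → ∀ w → ExtendsSome s w → ExtendsSome s′ w
run-extends⁺ ε        w any = any
run-extends⁺ (r ◅ rs) w any = run-extends⁺ rs w (⟹-extends⁺ r w any)

run-extends⁻ : ∀ {s s′ : List (Quiver n)} → Star _⟹_ s s′ → ∀ w → ExtendsSome s′ w → ExtendsSome s w
run-extends⁻ ε        w any = any
run-extends⁻ (r ◅ rs) w any = ⟹-extends⁻ r w (run-extends⁻ rs w any)

run-disjoint : ∀ {s s′ : List (Quiver n)} → Star _⟹_ s s′ → AllPairs Disjoint s → AllPairs Disjoint s′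
run-disjoint ε        s# = s#
run-disjoint (r ◅ rs) s# = run-disjoint rs (⟹-disjoint r s#)

step-exists : ∀ (R : Quiver n) → ¬ IsToricTotalOrder R → ∃[ Rs ] R ⇝ Rs
step-exists R ¬total with step-applies R ¬total
... | inj₁ (a , b , cond)     = _ , stepA ¬total cond (stepA-addable {R = R} cond)
... | inj₂ (a , b , v , cond) = _ , stepB {R′ = P} ¬total cond e src
    (stepB-addable {R = R} cond {P} e src) (stepB-addable′ {R = R} cond {P} e src)
  where
  P = raise (closure R) v
  e = raise-∼ (closure R) v
  src = raise-source (closure R) v

step-at : ∀ {s : List (Quiver n)} {R Rs} → R ∈ s → R ⇝ Rs → ∃[ s′ ] s ⟹ s′
step-at (here refl) st = _ , here st
step-at (there R∈)  st = let s′ , st′ = step-at R∈ st in _ , there st′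

terminated⇒total : ∀ {s : List (Quiver n)} → Terminated s → ∀ {P} → P ∈ s → IsToricTotalOrder P
terminated⇒total stop {P} P∈ with complete-or-gap (closure P)
... | inj₁ total             = total
... | inj₂ (i , j , i≢j , gap) =
  let Rs , st = step-exists P (λ total → gap (total i j i≢j))
      s′ , st′ = step-at P∈ st
  in contradiction st′ (stop s′)

-- The orders extending some member of the list stay the same throughout the run. At the end every
-- member is total, since otherwise a step would apply, and for a total member extension is the same
-- as correspondence.
enumerates : ∀ (Q : Quiver n) s → Star _⟹_ (Q ∷ []) s → Terminated s → Enumerates s (𝓛 Q)
enumerates Q s run stop = record
  { total    = All.tabulate λ {P} P∈ → corresponding-order {P = P} (terminated⇒total stop P∈)
  ; elements = λ w → mk⇔
      (λ L → let P , P∈ , ext = find (run-extends⁺ run w (here (𝓛⇒extends Q w (λ {x} → L {x}))))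
             in lose P∈ (extends⇒corresponds {P = P} {w} (terminated⇒total stop P∈) ext))
      (λ any → let P , P∈ , c = find any
                   ext = run-extends⁻ run w (lose P∈ (corresponds⇒extends {P = P} {w} c))
               in λ {x} → extends⇒𝓛 Q w (singleton⁻ w ext) {x})
  ; distinct = AllPairs.map
      (λ {P} {P′} P#P′ w c c′ → P#P′ w (corresponds⇒extends {P = P} {w} c) (corresponds⇒extends {P = P′} {w} c′))
      (run-disjoint run ([] ∷ []))
  }
  where
  singleton⁻ : ∀ w → ExtendsSome (Q ∷ []) w → Extends Q (Before w)
  singleton⁻ w (here ext) = ext

corollary7p3 : (n : ℕ) →
    ((R : Quiver n) → ¬ IsToricTotalOrder R →
        ((∃[ a ] ∃[ b ] ConditionA R a b) ⊎ (∃[ a ] ∃[ b ] ∃[ v ] ConditionB R a b v))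
      × (∀ a b → ConditionA R a b →
           Σ[ ok ∈ Addable R a b ] 𝓛 R ≐ 𝓛 (addArc R a b ok))
      × (∀ a b v → ConditionB R a b v →
           (∃[ R′ ] closure R ∼ R′ × IsSource R′ v)
         × (∀ R′ → closure R ∼ R′ → IsSource R′ v →
              Σ[ ok ∈ Addable R′ a b ] Σ[ ok′ ∈ Addable R′ b a ]
                  𝓛 R ≐ 𝓛 (addArc R′ a b ok) ∪ 𝓛 (addArc R′ b a ok′)
                × Empty (𝓛 (addArc R′ a b ok) ∩ 𝓛 (addArc R′ b a ok′)))))
    × ((Q : Quiver n) →
        Acc (λ s′ s → s ⟹ s′) (Q ∷ [])
      × (∀ s → Star _⟹_ (Q ∷ []) s → Terminated s → Enumerates s (𝓛 Q)))
corollary7p3 n = (λ R ¬total → step-applies R ¬total , stepA-𝓛 R , stepB-𝓛 R) , λ Q → terminates Q , enumerates Q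
  where
  stepA-𝓛 : ∀ R a b → ConditionA R a b → Σ[ ok ∈ Addable R a b ] 𝓛 R ≐ 𝓛 (addArc R a b ok)
  stepA-𝓛 R a b cond = ok ,
    (λ {w} L {x} → extends⇒𝓛 R⁺ w (stepA-extends w {R} cond ok (𝓛⇒extends R w (λ {x} → L {x}))) {x}) ,
    (λ {w} L {x} → extends⇒𝓛 R w (addArc-extends {Q = R} {Before w} {ok = ok} (𝓛⇒extends R⁺ w (λ {x} → L {x}))) {x})
    where
    ok = stepA-addable {R = R} cond
    R⁺ = addArc R a b ok
  stepB-𝓛 : ∀ R a b v → ConditionB R a b v →
            (∃[ R′ ] closure R ∼ R′ × IsSource R′ v)
          × (∀ R′ → closure R ∼ R′ → IsSource R′ v →
               Σ[ ok ∈ Addable R′ a b ] Σ[ ok′ ∈ Addable R′ b a ]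
                   𝓛 R ≐ 𝓛 (addArc R′ a b ok) ∪ 𝓛 (addArc R′ b a ok′)
                 × Empty (𝓛 (addArc R′ a b ok) ∩ 𝓛 (addArc R′ b a ok′)))
  stepB-𝓛 R a b v cond = (raise (closure R) v , raise-∼ (closure R) v , raise-source (closure R) v) , λ P e src →
    let ok  = stepB-addable {R = R} cond {P} e src
        ok′ = stepB-addable′ {R = R} cond {P} e src
        P₁  = addArc P a b ok
        P₂  = addArc P b a ok′
    in ok , ok′ ,
       ( (λ {w} L → Sum.map (λ e {x} → extends⇒𝓛 P₁ w e {x}) (λ e {x} → extends⇒𝓛 P₂ w e {x})
            (stepB-split w {R} cond {P} e src {ok} {ok′} (𝓛⇒extends R w (λ {x} → L {x}))))
       , (λ {w} → [ (λ L {x} → extends⇒𝓛 R w (stepB-extends w {R} {P} e {ok = ok} (𝓛⇒extends P₁ w (λ {x} → L {x}))) {x})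
                  , (λ L {x} → extends⇒𝓛 R w (stepB-extends w {R} {P} e {ok = ok′} (𝓛⇒extends P₂ w (λ {x} → L {x}))) {x}) ]′) ) ,
       λ w (L₁ , L₂) → stepB-disjoint w {R} cond {P} e src {ok} {ok′}
         (𝓛⇒extends P₁ w (λ {x} → L₁ {x})) (𝓛⇒extends P₂ w (λ {x} → L₂ {x}))
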